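{- Let $M$ be a connected non-bipartite binary matroid. The following are equivalent: (i) $M$ is odd-$C_3^+$-free; (ii) $M$ has a totally odd circuit basis; (iii) every odd cycle basis of $M$ is totally odd.
   Context: Matroids are loopless. A matroid is binary if representable over $\mathbb{F}_2$; connected if it has at least two elements and any two distinct elements lie in a common circuit; bipartite if all its circuits have even cardinality. A cycle is a union of disjoint circuits, odd if it has an odd number of elements. For binary $M$ with ground set $S$, the cycles' incidence vectors form a subspace $\mathcal{C}(M)\subseteq\mathbb{F}_2^S$; a cycle basis is a set of cycles whose incidence vectors form a basis of it, a circuit basis is a cycle basis consisting of circuits. A cycle basis is odd if all elements are odd; an odd cycle basis is totally odd if any two of its elements share an odd number of elements. Graphs are finite, may have parallel edges but no loops; a totally odd subdivision of a graph $H$ replaces each edge $e$ by a path with an odd number of edges joining the ends of $e$, paths for distinct edges sharing no inner vertices. $C_3^+$ is the triangle $K_3$ with one edge doubled by a parallel edge; an odd-$C_3^+$ graph is a totally odd subdivision of $C_3^+$. An odd-$C_3^+$ of $M$ is a restriction of $M$ isomorphic to the circuit matroid of an odd-$C_3^+$ graph, and $M$ is odd-$C_3^+$-free if it has none. -}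

module Defs where

open import Data.Nat using (ℕ; zero; suc; _%_)
open import Data.Bool using (Bool; true; false; _xor_)
open import Data.Fin using (Fin; zero; suc; toℕ; inject₁; fromℕ)
open import Data.Fin.Subset using (Subset; _∩_; _∪_; ⊥; ⁅_⁆; _∈_; _⊆_; _⊂_; ∣_∣; Nonempty)
open import Data.Vec using (Vec; tabulate; zipWith)
open import Data.Product using (Σ; ∃; _×_; _,_; proj₁; proj₂)
open import Data.Sum using (_⊎_)
open import Relation.Binary.PropositionalEquality using (_≡_; _≢_)
open import Relation.Nullary using (¬_)
open import Function.Bundles using (_⇔_)

Even : ℕ → Set
Even k = k % 2 ≡ 0

Odd : ℕ → Set
Odd k = k % 2 ≡ 1

-- Binary matroids: a matroid on ground set Fin n represented over F₂
-- by an (r × n) 0/1 matrix A (columns = elements).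

record BinMatroid (n : ℕ) : Set where
  field
    rows : ℕ
    A    : Fin rows → Fin n → Bool
open BinMatroid public

-- the columns indexed by C sum to zero over F₂
ZeroSum : ∀ {n} → BinMatroid n → Subset n → Set
ZeroSum M C = ∀ (r : Fin (rows M)) → Even ∣ C ∩ tabulate (A M r) ∣

Dependent : ∀ {n} → BinMatroid n → Subset n → Set
Dependent M C = ∃ λ D → D ⊆ C × Nonempty D × ZeroSum M D

Circuit : ∀ {n} → BinMatroid n → Subset n → Set
Circuit M C = Dependent M C × (∀ D → D ⊂ C → ¬ Dependent M D)

Loopless : ∀ {n} → BinMatroid n → Set
Loopless M = ∀ x → ¬ Circuit M ⁅ x ⁆

Connected : ∀ {n} → BinMatroid n → Set
Connected {n} M = (Σ (Fin n) λ x → Σ (Fin n) λ y → x ≢ y)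
  × (∀ x y → x ≢ y → ∃ λ C → Circuit M C × x ∈ C × y ∈ C)

Bipartite : ∀ {n} → BinMatroid n → Set
Bipartite M = ∀ C → Circuit M C → Even ∣ C ∣

⋃F : ∀ {n k} → (Fin k → Subset n) → Subset n
⋃F {k = zero}  F = ⊥
⋃F {k = suc k} F = F zero ∪ ⋃F (λ i → F (suc i))

Cycle : ∀ {n} → BinMatroid n → Subset n → Set
Cycle {n} M C = Σ ℕ λ k → Σ (Fin k → Subset n) λ Cs →
    (∀ i → Circuit M (Cs i))
  × (∀ i j → i ≢ j → Cs i ∩ Cs j ≡ ⊥)
  × C ≡ ⋃F Cs

_⊕_ : ∀ {n} → Subset n → Subset n → Subset n
p ⊕ q = zipWith _xor_ p q

lincomb : ∀ {n k} → (Fin k → Subset n) → (Fin k → Bool) → Subset n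
lincomb {k = zero}  B c = ⊥
lincomb {k = suc k} B c with c zero
... | true  = B zero ⊕ lincomb (λ i → B (suc i)) (λ i → c (suc i))
... | false = lincomb (λ i → B (suc i)) (λ i → c (suc i))

record CycleBasis {n} (M : BinMatroid n) (k : ℕ) (B : Fin k → Subset n) : Set where
  field
    cycles      : ∀ i → Cycle M (B i)
    independent : ∀ (c : Fin k → Bool) → lincomb B c ≡ ⊥ → ∀ i → c i ≡ false
    spanning    : ∀ C → Cycle M C → ∃ λ (c : Fin k → Bool) → lincomb B c ≡ C

CircuitBasis : ∀ {n} (M : BinMatroid n) (k : ℕ) → (Fin k → Subset n) → Set
CircuitBasis M k B = CycleBasis M k B × (∀ i → Circuit M (B i))

OddCycleBasis : ∀ {n} (M : BinMatroid n) (k : ℕ) → (Fin k → Subset n) → Set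
OddCycleBasis M k B = CycleBasis M k B × (∀ i → Odd ∣ B i ∣)

TotallyOddCycleBasis : ∀ {n} (M : BinMatroid n) (k : ℕ) → (Fin k → Subset n) → Set
TotallyOddCycleBasis M k B =
  OddCycleBasis M k B × (∀ i j → i ≢ j → Odd ∣ B i ∩ B j ∣)

record Graph : Set where
  field
    nv   : ℕ
    ne   : ℕ
    ends : Fin ne → Fin nv × Fin nv
    noLoop : ∀ e → proj₁ (ends e) ≢ proj₂ (ends e)
open Graph public

Joins : (G : Graph) → Fin (ne G) → Fin (nv G) → Fin (nv G) → Set
Joins G e a b = ends G e ≡ (a , b) ⊎ ends G e ≡ (b , a)

-- D is the edge set of a cycle of G: closed walk v₀ e₀ v₁ … e_{k-1} v_k = v₀
-- with k ≥ 1, distinct vertices v₀ … v_{k-1} and distinct edges.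
GraphCircuit : (G : Graph) → Subset (ne G) → Set
GraphCircuit G D = Σ ℕ λ k →
  Σ (Fin (suc (suc k)) → Fin (nv G)) λ vs →
  Σ (Fin (suc k) → Fin (ne G)) λ es →
    (∀ i j → vs (inject₁ i) ≡ vs (inject₁ j) → i ≡ j)
  × vs (fromℕ (suc k)) ≡ vs zero
  × (∀ i j → es i ≡ es j → i ≡ j)
  × (∀ i → Joins G (es i) (vs (inject₁ i)) (vs (suc i)))
  × (∀ e → (e ∈ D → ∃ λ i → es i ≡ e) × ((∃ λ i → es i ≡ e) → e ∈ D))

-- C₃⁺ : triangle on {0,1,2} with edge 01 doubled
C3+ends : Fin 4 → Fin 3 × Fin 3
C3+ends zero = (zero , suc zero)
C3+ends (suc zero) = (zero , suc zero)
C3+ends (suc (suc zero)) = (suc zero , suc (suc zero))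
C3+ends (suc (suc (suc zero))) = (suc (suc zero) , zero)

C3+noLoop : ∀ e → proj₁ (C3+ends e) ≢ proj₂ (C3+ends e)
C3+noLoop zero ()
C3+noLoop (suc zero) ()
C3+noLoop (suc (suc zero)) ()
C3+noLoop (suc (suc (suc zero))) ()

C3+ : Graph
C3+ = record { nv = 3 ; ne = 4 ; ends = C3+ends ; noLoop = C3+noLoop }

-- position i of a path with ℓ edges (vertices 0..ℓ) is an inner vertex
Inner : ∀ {ℓ} → Fin (suc ℓ) → Set
Inner {ℓ} i = toℕ i ≢ 0 × toℕ i ≢ ℓ

record TotallyOddSubdivision (H G : Graph) : Set where
  field
    branch    : Fin (nv H) → Fin (nv G)
    branchInj : ∀ u w → branch u ≡ branch w → u ≡ w
    len       : Fin (ne H) → ℕ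
    lenOdd    : ∀ e → Odd (len e)
    pv        : ∀ e → Fin (suc (len e)) → Fin (nv G)
    pe        : ∀ e → Fin (len e) → Fin (ne G)
    pvInj     : ∀ e i j → pv e i ≡ pv e j → i ≡ j
    pvStart   : ∀ e → pv e zero ≡ branch (proj₁ (ends H e))
    pvEnd     : ∀ e → pv e (fromℕ (len e)) ≡ branch (proj₂ (ends H e))
    peJoins   : ∀ e i → Joins G (pe e i) (pv e (inject₁ i)) (pv e (suc i))
    innerNotBranch : ∀ e i u → Inner {len e} i → pv e i ≢ branch u
    innerDisjoint  : ∀ e e' i i' → e ≢ e' → Inner {len e} i → Inner {len e'} i'
                       → pv e i ≢ pv e' i'
    vertCover : ∀ w → (∃ λ u → branch u ≡ w) ⊎ (∃ λ e → ∃ λ i → pv e i ≡ w)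
    edgeCover : ∀ g → ∃ λ e → ∃ λ i → pe e i ≡ g
    edgeInj   : ∀ e e' i i' → pe e i ≡ pe e' i' → e ≡ e' × toℕ i ≡ toℕ i'

OddC3+Graph : Graph → Set
OddC3+Graph G = TotallyOddSubdivision C3+ G

-- M has a restriction M|X isomorphic to the circuit matroid of G:
-- an injection f : E(G) → S with image X such that, for every D ⊆ E(G),
-- D is a circuit of M(G) iff f(D) is a circuit of M (equivalently of M|X).
HasRestrictionIsoTo : ∀ {n} → BinMatroid n → Graph → Set
HasRestrictionIsoTo {n} M G = Σ (Fin (ne G) → Fin n) λ f →
    (∀ e e' → f e ≡ f e' → e ≡ e')
  × (∀ (D : Subset (ne G)) (C : Subset n)
       → (∀ x → (x ∈ C → ∃ λ e → e ∈ D × f e ≡ x) × ((∃ λ e → e ∈ D × f e ≡ x) → x ∈ C))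
       → (GraphCircuit G D ⇔ Circuit M C))

OddC3+Free : ∀ {n} → BinMatroid n → Set
OddC3+Free M = ∀ (G : Graph) → OddC3+Graph G → ¬ HasRestrictionIsoTo M G

HasTotallyOddCircuitBasis : ∀ {n} → BinMatroid n → Set
HasTotallyOddCircuitBasis M = Σ ℕ λ k → Σ (Fin k → Subset _) λ B →
  CircuitBasis M k B × TotallyOddCycleBasis M k B

EveryOddCycleBasisTotallyOdd : ∀ {n} → BinMatroid n → Set
EveryOddCycleBasisTotallyOdd M = ∀ k B → OddCycleBasis M k B → TotallyOddCycleBasis M k B

{-# OPTIONS --safe #-}
module Submission where

-- On the cycle space consider the alternating form ⟨C,D⟩ + |C||D| over F₂.  A basis of odd
-- cycles is totally odd iff the form vanishes on it, hence iff the form vanishes identically;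
-- on an odd-C₃⁺ it does not vanish.  In a connected non-bipartite binary matroid the odd circuits
-- span the cycle space: if E is an even circuit and K an odd circuit meeting E with K − E minimal,
-- then K + E is again an odd circuit.
--
-- Conversely, let C be an odd circuit and D a cycle not orthogonal to C, with D − C minimal.  Then
-- the only cycles inside C ∪ D are 0, C, D and C + D, so either C ∪ D is a theta, which by parity
-- is an odd-C₃⁺, or C and D (or C and C + D) are disjoint odd circuits.  In the latter case let K
-- be a circuit meeting both with K − (C ∪ D) minimal: D forms a theta with K and with K + C, and
-- exactly one of them is an odd-C₃⁺.

open import Defs
open import Algebra.Bundles using (CommutativeRing)
open import Algebra.Properties.CommutativeSemigroup using (interchange)
open import Data.Bool using (Bool; true; false; not; _∧_; _xor_; if_then_else_)
open import Data.Bool.Properties using (xor-assoc; xor-comm; xor-same; xor-identityʳ; ∧-comm; ∧-zeroʳ; ∧-distribˡ-xor; xor-∧-commutativeRing) renaming (_≟_ to _≟ᵇ_)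
open import Data.Empty using (⊥-elim)
open import Data.Fin using (Fin; zero; suc; inject₁; fromℕ; toℕ; opposite; _↑ˡ_; _↑ʳ_; splitAt) renaming (_≟_ to _≟ᶠ_)
open import Data.Fin.Patterns using (0F; 1F; 2F; 3F)
open import Data.Fin.Properties using (any?; all?; suc-injective; inject₁-injective; opposite-involutive; toℕ-inject₁; toℕ-fromℕ; toℕ<n; toℕ-injective; splitAt-↑ˡ; splitAt-↑ʳ; splitAt⁻¹-↑ˡ; splitAt⁻¹-↑ʳ)
open import Data.Fin.Relation.Unary.Top using (view; ‵fromℕ; ‵inject₁; view-fromℕ; view-inject₁)
open import Data.Fin.Subset using (Subset; _∩_; _∪_; _─_; ⊥; ⁅_⁆; _∈_; _∉_; _⊆_; _⊂_; ∣_∣; Nonempty)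
open import Data.Fin.Subset.Properties
open import Data.List using (List; []; _∷_; _++_; map)
open import Data.List.Membership.Propositional using () renaming (_∈_ to _∈ˡ_)
open import Data.List.Membership.Propositional.Properties using (∈-++⁺ˡ; ∈-++⁺ʳ; ∈-map⁺)
open import Data.List.Relation.Unary.Any using (here; there)
open import Data.Nat using (ℕ; zero; suc; _+_; _≤_; _<_; _%_; _<?_)
open import Data.Nat.Induction using (<-wellFounded)
open import Data.Nat.Properties using (≮⇒≥; <⇒≱; <-irrefl; n<1+n; m+n≡0⇒m≡0) renaming (_≟_ to _≟ⁿ_)
open import Data.Product using (Σ; ∃; _×_; _,_; proj₁; proj₂)
open import Data.Sum using (_⊎_; inj₁; inj₂; swap)
open import Data.Sum.Properties using (inj₁-injective; inj₂-injective)
open import Data.Vec using ([]; _∷_; here; there; lookup; tabulate)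
open import Data.Vec.Properties using (lookup∘tabulate; zipWith-assoc; zipWith-comm; zipWith-identityˡ; zipWith-identityʳ; ≡-dec)
open import Function using (_∘_)
open import Function.Bundles using (Equivalence; _⇔_; mk⇔)
open import Induction.WellFounded using (Acc; acc)
open import Relation.Binary.PropositionalEquality using (_≡_; _≢_; refl; sym; trans; cong; cong₂; subst; module ≡-Reasoning)
open import Relation.Nullary using (¬_; Dec; yes; no; ¬?; contradiction; _×-dec_)
open import Relation.Nullary.Decidable using (map′; decidable-stable)
open import Relation.Unary using (Decidable)

-- For odd `C` the form is the parity of `D ─ C`, since |C ∩ D| + |D| = |D ─ C| + 2|C ∩ D|. This is
-- why sets are measured by what they have outside `C`: a nonzero value survives in one of two
-- summands with fewer points there, and in a theta with paths `C ─ D`, `D ─ C` and `C ∩ D` it says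
-- that the second path is odd. As `C` is odd, exactly one of the other two paths is odd as well;
-- the remaining even path, cut after one element, supplies odd paths for the two edges of C₃⁺ that
-- are not doubled. The recurrent mechanism: a zero-sum set that agrees with the expected one
-- outside a circuit differs from it by a zero-sum set inside that circuit, hence by nothing or by
-- the whole circuit. The obstacle is the isomorphism with the circuit matroid of a concrete graph.
-- Thetas are therefore described by their four zero-sum sets, and a circuit of the graph is shown
-- to be zero-sum by reading each row of the matrix as a cut, which every closed walk crosses an
-- even number of times.

private variable
  a b n k : ℕ
  p q r : Subset n
  x : Fin n
  V : Set

-- The vector space of subsets

⊕-comm : (p q : Subset n) → p ⊕ q ≡ q ⊕ p
⊕-comm = zipWith-comm xor-comm

⊕-assoc : (p q r : Subset n) → (p ⊕ q) ⊕ r ≡ p ⊕ (q ⊕ r)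
⊕-assoc = zipWith-assoc xor-assoc

⊕-identityˡ : (p : Subset n) → ⊥ ⊕ p ≡ p
⊕-identityˡ = zipWith-identityˡ (λ _ → refl)

⊕-identityʳ : (p : Subset n) → p ⊕ ⊥ ≡ p
⊕-identityʳ = zipWith-identityʳ xor-identityʳ

⊕-self : (p : Subset n) → p ⊕ p ≡ ⊥
⊕-self []      = refl
⊕-self (b ∷ p) = cong₂ _∷_ (xor-same b) (⊕-self p)

⊕-cancelˡ : (p q : Subset n) → p ⊕ (p ⊕ q) ≡ q
⊕-cancelˡ p q = trans (sym (⊕-assoc p p q)) (trans (cong (_⊕ q) (⊕-self p)) (⊕-identityˡ q))

⊕-cancelʳ : (p q : Subset n) → (p ⊕ q) ⊕ q ≡ p
⊕-cancelʳ p q = trans (⊕-assoc p q q) (trans (cong (p ⊕_) (⊕-self q)) (⊕-identityʳ p))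

⊕-solve : p ⊕ q ≡ r → p ≡ r ⊕ q
⊕-solve {p = p} {q = q} e = trans (sym (⊕-cancelʳ p q)) (cong (_⊕ q) e)

⊕-interchange : (p q r s : Subset n) → (p ⊕ q) ⊕ (r ⊕ s) ≡ (p ⊕ r) ⊕ (q ⊕ s)
⊕-interchange p q r s = begin
  (p ⊕ q) ⊕ (r ⊕ s)  ≡⟨ ⊕-assoc p q (r ⊕ s) ⟩
  p ⊕ (q ⊕ (r ⊕ s))  ≡⟨ cong (p ⊕_) (sym (⊕-assoc q r s)) ⟩
  p ⊕ ((q ⊕ r) ⊕ s)  ≡⟨ cong (λ t → p ⊕ (t ⊕ s)) (⊕-comm q r) ⟩
  p ⊕ ((r ⊕ q) ⊕ s)  ≡⟨ cong (p ⊕_) (⊕-assoc r q s) ⟩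
  p ⊕ (r ⊕ (q ⊕ s))  ≡⟨ sym (⊕-assoc p r (q ⊕ s)) ⟩
  (p ⊕ r) ⊕ (q ⊕ s)  ∎
  where open ≡-Reasoning

x∈p⊕q⁺ˡ : x ∈ p → x ∉ q → x ∈ p ⊕ q
x∈p⊕q⁺ˡ {q = false ∷ _} here        _   = here
x∈p⊕q⁺ˡ {q = true  ∷ _} here        x∉q = contradiction here x∉q
x∈p⊕q⁺ˡ {q = _ ∷ _}     (there x∈p) x∉q = there (x∈p⊕q⁺ˡ x∈p (x∉q ∘ there))

x∈p⊕q⁺ʳ : x ∉ p → x ∈ q → x ∈ p ⊕ q
x∈p⊕q⁺ʳ {p = p} {q = q} x∉p x∈q = subst (_ ∈_) (⊕-comm q p) (x∈p⊕q⁺ˡ x∈q x∉p)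

x∈p⊕q⁻ : (p q : Subset n) → x ∈ p ⊕ q → (x ∈ p × x ∉ q) ⊎ (x ∉ p × x ∈ q)
x∈p⊕q⁻ {x = zero}  (true  ∷ p) (false ∷ q) _         = inj₁ (here , λ ())
x∈p⊕q⁻ {x = zero}  (false ∷ p) (true  ∷ q) _         = inj₂ ((λ ()) , here)
x∈p⊕q⁻ {x = suc x} (_ ∷ p)     (_ ∷ q)     (there i) with x∈p⊕q⁻ p q i
... | inj₁ (x∈p , x∉q) = inj₁ (there x∈p , λ { (there x∈q) → x∉q x∈q })
... | inj₂ (x∉p , x∈q) = inj₂ ((λ { (there x∈p) → x∉p x∈p }) , there x∈q)

x∈p⊕q⇒x∉q : x ∈ p ⊕ q → x ∈ p → x ∉ q
x∈p⊕q⇒x∉q {p = p} {q = q} x∈ x∈p with x∈p⊕q⁻ p q x∈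
... | inj₁ (_ , x∉q) = x∉q
... | inj₂ (x∉p , _) = contradiction x∈p x∉p

x∈p⊕q∧x∉q⇒x∈p : x ∈ p ⊕ q → x ∉ q → x ∈ p
x∈p⊕q∧x∉q⇒x∈p {p = p} {q = q} x∈ x∉q with x∈p⊕q⁻ p q x∈
... | inj₁ (x∈p , _) = x∈p
... | inj₂ (_ , x∈q) = contradiction x∈q x∉q

x∈p⊕q∧x∉p⇒x∈q : x ∈ p ⊕ q → x ∉ p → x ∈ q
x∈p⊕q∧x∉p⇒x∈q {p = p} {q = q} x∈ x∉p = x∈p⊕q∧x∉q⇒x∈p (subst (_ ∈_) (⊕-comm p q) x∈) x∉p

p⊕q⊆r : p ⊆ r → q ⊆ r → p ⊕ q ⊆ r
p⊕q⊆r {p = p} {q = q} p⊆r q⊆r x∈ with x∈p⊕q⁻ p q x∈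
... | inj₁ (x∈p , _) = p⊆r x∈p
... | inj₂ (_ , x∈q) = q⊆r x∈q

⊕≡∪ : (∀ {x} → x ∈ p → x ∉ q) → p ⊕ q ≡ p ∪ q
⊕≡∪ {p = p} {q = q} disjoint = ⊆-antisym
  (p⊕q⊆r (p⊆p∪q q) (q⊆p∪q p q))
  (λ x∈ → case-∪ (x∈p∪q⁻ p q x∈))
  where
  case-∪ : ∀ {x} → x ∈ p ⊎ x ∈ q → x ∈ p ⊕ q
  case-∪ (inj₁ x∈p) = x∈p⊕q⁺ˡ x∈p (disjoint x∈p)
  case-∪ (inj₂ x∈q) = x∈p⊕q⁺ʳ (λ x∈p → disjoint x∈p x∈q) x∈q

x∈p─q⁻ : (p q : Subset n) → x ∈ p ─ q → x ∈ p × x ∉ q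
x∈p─q⁻ p q x∈ = p─q⊆p p q x∈ , x∉q p q x∈
  where
  x∉q : ∀ {n} {x : Fin n} (p q : Subset n) → x ∈ p ─ q → x ∉ q
  x∉q (true ∷ _)  (true ∷ _) ()  here
  x∉q (false ∷ _) (true ∷ _) ()  here
  x∉q (_ ∷ p) (_ ∷ q) (there i) (there j) = x∉q p q i j

⊆-or-witness : (p q : Subset n) → p ⊆ q ⊎ (∃ λ x → x ∈ p × x ∉ q)
⊆-or-witness p q with any? (λ x → (x ∈? p) ×-dec ¬? (x ∈? q))
... | yes w = inj₂ w
... | no ¬w = inj₁ λ {x} x∈p → decidable-stable (x ∈? q) λ x∉q → ¬w (x , x∈p , x∉q)

⊆∧≤⇒⊇ : p ⊆ q → ∣ q ∣ ≤ ∣ p ∣ → q ⊆ p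
⊆∧≤⇒⊇ {p = p} {q = q} p⊆q ∣q∣≤∣p∣ with ⊆-or-witness q p
... | inj₁ q⊆p = q⊆p
... | inj₂ w   = contradiction ∣q∣≤∣p∣ (<⇒≱ (p⊂q⇒∣p∣<∣q∣ (p⊆q , w)))

p≢⊥⇒nonempty : p ≢ ⊥ → Nonempty p
p≢⊥⇒nonempty {p = p} p≢⊥ with nonempty? p
... | yes ne = ne
... | no ¬ne = contradiction (Empty-unique ¬ne) p≢⊥

nonempty⇒p≢⊥ : Nonempty p → p ≢ ⊥
nonempty⇒p≢⊥ (x , x∈p) refl = ∉⊥ x∈p

_≟ˢ_ : (p q : Subset n) → Dec (p ≡ q)
_≟ˢ_ = ≡-dec _≟ᵇ_

minimiser : {P : Subset n → Set} → Decidable P → (μ : Subset n → ℕ) → ∃ P →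
            ∃ λ K → P K × (∀ K′ → P K′ → μ K ≤ μ K′)
minimiser {n} {P} P? μ (K₀ , PK₀) = go K₀ PK₀ (<-wellFounded (μ K₀))
  where
  go : ∀ K → P K → Acc _<_ (μ K) → ∃ λ K → P K × (∀ K′ → P K′ → μ K ≤ μ K′)
  go K PK (acc rec) with anySubset? (λ K′ → P? K′ ×-dec (μ K′ <? μ K))
  ... | yes (K′ , PK′ , less) = go K′ PK′ (rec less)
  ... | no ¬less = K , PK , λ K′ PK′ → ≮⇒≥ λ less → ¬less (K′ , PK′ , less)

allSubsets : ∀ n → List (Subset n)
allSubsets zero    = [] ∷ []
allSubsets (suc n) = map (true ∷_) (allSubsets n) ++ map (false ∷_) (allSubsets n)

∈-allSubsets : (p : Subset n) → p ∈ˡ allSubsets n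
∈-allSubsets []          = here refl
∈-allSubsets (true  ∷ p) = ∈-++⁺ˡ (∈-map⁺ _ (∈-allSubsets p))
∈-allSubsets (false ∷ p) = ∈-++⁺ʳ (map (true ∷_) (allSubsets _)) (∈-map⁺ _ (∈-allSubsets p))

-- Parity and the bilinear forms

parityℕ : ℕ → Bool
parityℕ zero    = false
parityℕ (suc m) = not (parityℕ m)

parityℕ-% : ∀ m → m % 2 ≡ (if parityℕ m then 1 else 0)
parityℕ-% zero          = refl
parityℕ-% (suc zero)    = refl
parityℕ-% (suc (suc m)) with parityℕ m | parityℕ-% m
... | true  | e = e
... | false | e = e

odd⇒parityℕ : ∀ m → Odd m → parityℕ m ≡ true
odd⇒parityℕ m o with parityℕ m | parityℕ-% m
... | true  | _ = refl
... | false | e with trans (sym o) e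
... | ()

even⇒parityℕ : ∀ m → Even m → parityℕ m ≡ false
even⇒parityℕ m o with parityℕ m | parityℕ-% m
... | false | _ = refl
... | true  | e with trans (sym o) e
... | ()

parityℕ⇒odd : ∀ m → parityℕ m ≡ true → Odd m
parityℕ⇒odd m e = trans (parityℕ-% m) (cong (if_then 1 else 0) e)

parityℕ⇒even : ∀ m → parityℕ m ≡ false → Even m
parityℕ⇒even m e = trans (parityℕ-% m) (cong (if_then 1 else 0) e)

-- Recursion along the vector, in place of counting with `∣_∣`, makes linearity under `_⊕_` a
-- componentwise fact.
parity : Subset n → Bool
parity []      = false
parity (b ∷ p) = b xor parity p

parity-∣∣ : (p : Subset n) → parityℕ ∣ p ∣ ≡ parity p
parity-∣∣ []          = refl
parity-∣∣ (true  ∷ p) = cong not (parity-∣∣ p)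
parity-∣∣ (false ∷ p) = parity-∣∣ p

odd⇒parity : (p : Subset n) → Odd ∣ p ∣ → parity p ≡ true
odd⇒parity p o = trans (sym (parity-∣∣ p)) (odd⇒parityℕ ∣ p ∣ o)

even⇒parity : (p : Subset n) → Even ∣ p ∣ → parity p ≡ false
even⇒parity p o = trans (sym (parity-∣∣ p)) (even⇒parityℕ ∣ p ∣ o)

parity⇒odd : (p : Subset n) → parity p ≡ true → Odd ∣ p ∣
parity⇒odd p e = parityℕ⇒odd ∣ p ∣ (trans (parity-∣∣ p) e)

parity⇒even : (p : Subset n) → parity p ≡ false → Even ∣ p ∣
parity⇒even p e = parityℕ⇒even ∣ p ∣ (trans (parity-∣∣ p) e)

xor-interchange : ∀ a b c d → (a xor b) xor (c xor d) ≡ (a xor c) xor (b xor d)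
xor-interchange = interchange (CommutativeRing.+-commutativeSemigroup xor-∧-commutativeRing)

xor≡false⇒≡ : ∀ a b → a xor b ≡ false → a ≡ b
xor≡false⇒≡ true  true  _ = refl
xor≡false⇒≡ false false _ = refl

parity-⊥ : ∀ n → parity (⊥ {n}) ≡ false
parity-⊥ zero    = refl
parity-⊥ (suc n) = parity-⊥ n

parity-⊕ : (p q : Subset n) → parity (p ⊕ q) ≡ parity p xor parity q
parity-⊕ []      []      = refl
parity-⊕ (a ∷ p) (b ∷ q) = trans (cong ((a xor b) xor_) (parity-⊕ p q)) (xor-interchange a b (parity p) (parity q))

∩-distribˡ-⊕ : (p q r : Subset n) → p ∩ (q ⊕ r) ≡ (p ∩ q) ⊕ (p ∩ r)
∩-distribˡ-⊕ []      []      []      = refl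
∩-distribˡ-⊕ (a ∷ p) (b ∷ q) (c ∷ r) = cong₂ _∷_ (∧-distribˡ-xor a b c) (∩-distribˡ-⊕ p q r)

dot : Subset n → Subset n → Bool
dot p q = parity (p ∩ q)

dot-comm : (p q : Subset n) → dot p q ≡ dot q p
dot-comm p q = cong parity (∩-comm p q)

dot-self : (p : Subset n) → dot p p ≡ parity p
dot-self p = cong parity (∩-idem p)

dot-⊕ʳ : (p q r : Subset n) → dot p (q ⊕ r) ≡ dot p q xor dot p r
dot-⊕ʳ p q r = trans (cong parity (∩-distribˡ-⊕ p q r)) (parity-⊕ (p ∩ q) (p ∩ r))

dot-⊕ˡ : (p q r : Subset n) → dot (p ⊕ q) r ≡ dot p r xor dot q r
dot-⊕ˡ p q r = trans (dot-comm (p ⊕ q) r) (trans (dot-⊕ʳ r p q) (cong₂ _xor_ (dot-comm r p) (dot-comm r q)))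

dot-⊥ˡ : (p : Subset n) → dot ⊥ p ≡ false
dot-⊥ˡ {n} p = trans (cong parity (∩-zeroˡ p)) (parity-⊥ n)

dot-disjoint : (∀ {x} → x ∈ p → x ∉ q) → dot p q ≡ false
dot-disjoint {n} {p} {q} disjoint = trans (cong parity (Empty-unique λ { (x , x∈) → disjoint (proj₁ (x∈p∩q⁻ p q x∈)) (proj₂ (x∈p∩q⁻ p q x∈)) })) (parity-⊥ n)

-- An alternating form; on odd cycles it vanishes exactly when the intersection is odd.
form : Subset n → Subset n → Bool
form p q = dot p q xor (parity p ∧ parity q)

form-⊕ʳ : (p q r : Subset n) → form p (q ⊕ r) ≡ form p q xor form p r
form-⊕ʳ p q r = begin
  dot p (q ⊕ r) xor (parity p ∧ parity (q ⊕ r))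
    ≡⟨ cong₂ _xor_ (dot-⊕ʳ p q r) (trans (cong (parity p ∧_) (parity-⊕ q r)) (∧-distribˡ-xor (parity p) (parity q) (parity r))) ⟩
  (dot p q xor dot p r) xor ((parity p ∧ parity q) xor (parity p ∧ parity r))
    ≡⟨ xor-interchange (dot p q) (dot p r) (parity p ∧ parity q) (parity p ∧ parity r) ⟩
  form p q xor form p r ∎
  where open ≡-Reasoning

form-comm : (p q : Subset n) → form p q ≡ form q p
form-comm p q = cong₂ _xor_ (dot-comm p q) (∧-comm (parity p) (parity q))

form-⊥ : (p : Subset n) → form p ⊥ ≡ false
form-⊥ {n} p = cong₂ _xor_ (trans (dot-comm p ⊥) (dot-⊥ˡ p)) (trans (cong (parity p ∧_) (parity-⊥ n)) (∧-zeroʳ (parity p)))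

-- The diagonal value is |p| + |p|², which is even.
form-self : (p : Subset n) → form p p ≡ false
form-self p rewrite dot-self p with parity p
... | true  = refl
... | false = refl

form≡false⇒odd-∩ : Odd ∣ p ∣ → Odd ∣ q ∣ → form p q ≡ false → Odd ∣ p ∩ q ∣
form≡false⇒odd-∩ {p = p} {q = q} op oq e rewrite odd⇒parity p op | odd⇒parity q oq = parity⇒odd (p ∩ q) (xor≡false⇒≡ _ true e)

odd-∩⇒form≡false : Odd ∣ p ∣ → Odd ∣ q ∣ → Odd ∣ p ∩ q ∣ → form p q ≡ false
odd-∩⇒form≡false {p = p} {q = q} op oq o rewrite odd⇒parity p op | odd⇒parity q oq | odd⇒parity (p ∩ q) o = refl

-- Linear combinations

lincomb-cong : (B : Fin k → Subset n) {c d : Fin k → Bool} → (∀ i → c i ≡ d i) → lincomb B c ≡ lincomb B d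
lincomb-cong {zero}  B c≗d = refl
lincomb-cong {suc k} B {c} {d} c≗d with c zero | d zero | c≗d zero
... | true  | true  | _ = cong (B zero ⊕_) (lincomb-cong (B ∘ suc) (c≗d ∘ suc))
... | false | false | _ = lincomb-cong (B ∘ suc) (c≗d ∘ suc)

lincomb-⊕ : (B : Fin k → Subset n) (c d : Fin k → Bool) →
            lincomb B (λ i → c i xor d i) ≡ lincomb B c ⊕ lincomb B d
lincomb-⊕ {zero}  B c d = sym (⊕-identityˡ ⊥)
lincomb-⊕ {suc k} B c d with c zero | d zero | lincomb-⊕ (B ∘ suc) (c ∘ suc) (d ∘ suc)
... | true  | true  | ih = trans ih (trans (sym (⊕-identityˡ _)) (trans (cong (_⊕ (lincomb (B ∘ suc) (c ∘ suc) ⊕ lincomb (B ∘ suc) (d ∘ suc))) (sym (⊕-self (B zero)))) (⊕-interchange (B zero) (B zero) _ _)))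
... | true  | false | ih = trans (cong (B zero ⊕_) ih) (sym (⊕-assoc (B zero) _ _))
... | false | true  | ih = trans (cong (B zero ⊕_) ih) (trans (sym (⊕-assoc (B zero) _ _)) (trans (cong (_⊕ _) (⊕-comm (B zero) _)) (⊕-assoc _ (B zero) _)))
... | false | false | ih = ih

lincomb-false : (B : Fin k → Subset n) → lincomb B (λ _ → false) ≡ ⊥
lincomb-false {zero}  B = refl
lincomb-false {suc k} B = lincomb-false (B ∘ suc)

record Subspace (P : Subset n → Set) : Set where
  field
    ⊥-closed : P ⊥
    ⊕-closed : ∀ {p q} → P p → P q → P (p ⊕ q)

lincomb-∈ : {P : Subset n → Set} → Subspace P → (B : Fin k → Subset n) → (∀ i → P (B i)) → ∀ c → P (lincomb B c)
lincomb-∈ {k = zero}  S B PB c = Subspace.⊥-closed S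
lincomb-∈ {k = suc k} S B PB c with c zero
... | true  = Subspace.⊕-closed S (PB zero) (lincomb-∈ S (B ∘ suc) (PB ∘ suc) (c ∘ suc))
... | false = lincomb-∈ S (B ∘ suc) (PB ∘ suc) (c ∘ suc)

-- Through this subspace, vanishing on a spanning family passes to the whole cycle space.
form-kernel : (p : Subset n) → Subspace (λ q → form p q ≡ false)
form-kernel p = record
  { ⊥-closed = form-⊥ p
  ; ⊕-closed = λ {q} {r} e f → trans (form-⊕ʳ p q r) (cong₂ _xor_ e f)
  }

Span : (Fin k → Subset n) → Subset n → Set
Span B p = ∃ λ c → lincomb B c ≡ p

span-subspace : (B : Fin k → Subset n) → Subspace (Span B)
span-subspace B = record
  { ⊥-closed = (λ _ → false) , lincomb-false B
  ; ⊕-closed = λ { (c , refl) (d , refl) → (λ i → c i xor d i) , lincomb-⊕ B c d }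
  }

-- Coefficient functions are traded for vectors in `Subset k`, which can be searched exhaustively.
span? : (B : Fin k → Subset n) → Decidable (Span B)
span? B p = map′ (λ { (c , e) → lookup c , e })
                 (λ { (c , e) → tabulate c , trans (lincomb-cong B (lookup∘tabulate c)) e })
                 (anySubset? (λ c → lincomb B (lookup c) ≟ˢ p))

Independent : (Fin k → Subset n) → Set
Independent B = ∀ c → lincomb B c ≡ ⊥ → ∀ i → c i ≡ false

extend : Subset n → (Fin k → Subset n) → Fin (suc k) → Subset n
extend v B zero    = v
extend v B (suc i) = B i

extend-independent : (v : Subset n) (B : Fin k → Subset n) → ¬ Span B v → Independent B → Independent (extend v B)
extend-independent v B v∉ ind c e with c zero in c₀
... | true  = contradiction (c ∘ suc , sym (trans (⊕-solve e) (⊕-identityˡ _))) v∉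
... | false = λ { zero → c₀ ; (suc i) → ind (c ∘ suc) e i }

-- Greedy extraction: a member of the list with `P` is adopted unless the members adopted from the
-- rest of the list already span it.
independent-spanning : {P : Subset n → Set} → Decidable P → (xs : List (Subset n)) →
  ∃ λ k → Σ (Fin k → Subset n) λ B → (∀ i → P (B i)) × Independent B × (∀ p → p ∈ˡ xs → P p → Span B p)
independent-spanning P? [] = 0 , (λ ()) , (λ ()) , (λ _ _ ()) , λ _ ()
independent-spanning P? (v ∷ xs) with independent-spanning P? xs
... | k , B , PB , ind , spans with P? v | span? B v
... | no ¬Pv | _      = k , B , PB , ind , λ { p (here refl) Pp → contradiction Pp ¬Pv ; p (there p∈) Pp → spans p p∈ Pp }
... | yes Pv | yes v∈ = k , B , PB , ind , λ { p (here refl) Pp → v∈ ; p (there p∈) Pp → spans p p∈ Pp }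
... | yes Pv | no v∉  = suc k , extend v B , (λ { zero → Pv ; (suc i) → PB i }) , extend-independent v B v∉ ind , spans′
  where
  spans′ : ∀ p → p ∈ˡ (v ∷ xs) → _ → Span (extend v B) p
  spans′ p (here refl) _ = (λ { zero → true ; (suc _) → false }) , trans (cong (v ⊕_) (lincomb-false B)) (⊕-identityʳ v)
  spans′ p (there p∈) Pp with spans p p∈ Pp
  ... | c , e = (λ { zero → false ; (suc i) → c i }) , e

-- Zero-sum sets, circuits and cycles

Meets : Subset n → Subset n → Set
Meets p q = ∃ λ x → x ∈ p × x ∈ q

meets? : (p q : Subset n) → Dec (Meets p q)
meets? p q = any? (λ x → (x ∈? p) ×-dec (x ∈? q))

module Matroid {n : ℕ} (M : BinMatroid n) where

  -- Zero-sum sets form the kernel of the matrix. They turn out to be exactly the cycles and stand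
  -- in for them in the arguments below, being decidable and visibly closed under addition.
  zeroSum-subspace : Subspace (ZeroSum M)
  zeroSum-subspace = record
    { ⊥-closed = λ r → parity⇒even (⊥ ∩ row r) (dot-⊥ˡ (row r))
    ; ⊕-closed = λ {p} {q} zp zq r → parity⇒even ((p ⊕ q) ∩ row r) (trans (dot-⊕ˡ p q (row r))
        (cong₂ _xor_ (even⇒parity (p ∩ row r) (zp r)) (even⇒parity (q ∩ row r) (zq r))))
    }
    where
    row : Fin (rows M) → Subset n
    row r = tabulate (A M r)

  open Subspace zeroSum-subspace public renaming (⊥-closed to zeroSum-⊥; ⊕-closed to zeroSum-⊕)

  zeroSum? : Decidable (ZeroSum M)
  zeroSum? C = all? (λ r → ∣ C ∩ tabulate (A M r) ∣ % 2 ≟ⁿ 0)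

  dependent? : Decidable (Dependent M)
  dependent? C = anySubset? (λ D → (D ⊆? C) ×-dec (nonempty? D ×-dec zeroSum? D))

  circuit? : Decidable (Circuit M)
  circuit? C = dependent? C ×-dec map′
    (λ none D D⊂C dep → none (D , D⊂C , dep))
    (λ min (D , D⊂C , dep) → min D D⊂C dep)
    (¬? (anySubset? (λ D → (D ⊂? C) ×-dec dependent? D)))

  zeroSum⇒dependent : ∀ {C} → ZeroSum M C → Nonempty C → Dependent M C
  zeroSum⇒dependent {C} zC neC = C , ⊆-refl , neC , zC

  circuit-minimal : ∀ {C D} → Circuit M C → ZeroSum M D → Nonempty D → D ⊆ C → C ⊆ D
  circuit-minimal {C} {D} (_ , min) zD neD D⊆C with ⊆-or-witness C D
  ... | inj₁ C⊆D = C⊆D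
  ... | inj₂ w   = contradiction (zeroSum⇒dependent {D} zD neD) (min D (D⊆C , w))

  circuit-zeroSum×nonempty : ∀ {C} → Circuit M C → ZeroSum M C × Nonempty C
  circuit-zeroSum×nonempty {C} CC@((D , D⊆C , neD , zD) , _) with ⊆-antisym D⊆C (circuit-minimal {C} CC zD neD D⊆C)
  ... | refl = zD , neD

  circuit-zeroSum : ∀ {C} → Circuit M C → ZeroSum M C
  circuit-zeroSum {C} CC = proj₁ (circuit-zeroSum×nonempty {C} CC)

  circuit-nonempty : ∀ {C} → Circuit M C → Nonempty C
  circuit-nonempty {C} CC = proj₂ (circuit-zeroSum×nonempty {C} CC)

  mkCircuit : ∀ {C} → ZeroSum M C → Nonempty C →
              (∀ {D} → ZeroSum M D → Nonempty D → D ⊆ C → C ⊆ D) → Circuit M C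
  mkCircuit {C} zC neC min = zeroSum⇒dependent {C} zC neC ,
    λ { D (D⊆C , x , x∈C , x∉D) (E , E⊆D , neE , zE) → x∉D (E⊆D (min zE neE (⊆-trans E⊆D D⊆C) x∈C)) }

  -- A minimal zero-sum subset of Z with property Q is a circuit as soon as Q passes
  -- from K to one of the two parts of every splitting of K.
  component : {Q : Subset n → Set} → Decidable Q → (∀ {K} → Q K → Nonempty K) →
              (∀ {K} D → D ⊆ K → Q K → Q D ⊎ Q (K ⊕ D)) →
              ∀ {Z} → ZeroSum M Z → Q Z → ∃ λ C → Circuit M C × C ⊆ Z × Q C
  component {Q} Q? ne split {Z} zZ QZ
    with minimiser (λ K → zeroSum? K ×-dec ((K ⊆? Z) ×-dec Q? K)) ∣_∣ (Z , zZ , ⊆-refl , QZ)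
  ... | K , (zK , K⊆Z , QK) , min = K , mkCircuit {K} zK (ne QK) minimal , K⊆Z , QK
    where
    minimal : ∀ {D} → ZeroSum M D → Nonempty D → D ⊆ K → K ⊆ D
    minimal {D} zD (x , x∈D) D⊆K with split D D⊆K QK
    ... | inj₁ QD  = ⊆∧≤⇒⊇ D⊆K (min D (zD , ⊆-trans D⊆K K⊆Z , QD))
    -- `K ⊕ D` is then a competitor inside `K`, so by minimality it is all of `K`, although it
    -- misses the point `x` of `D`.
    ... | inj₂ QKD = contradiction x∈D
      (x∈p⊕q⇒x∉q {p = K} (⊆∧≤⇒⊇ KD⊆K (min (K ⊕ D) (zeroSum-⊕ {K} {D} zK zD , ⊆-trans KD⊆K K⊆Z , QKD)) (D⊆K x∈D)) (D⊆K x∈D))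
      where
      KD⊆K : K ⊕ D ⊆ K
      KD⊆K = p⊕q⊆r ⊆-refl D⊆K

  circuit-through : ∀ {Z x} → ZeroSum M Z → x ∈ Z → ∃ λ C → Circuit M C × C ⊆ Z × x ∈ C
  circuit-through {x = x} = component (x ∈?_) (x ,_) split
    where
    split : ∀ {K} D → D ⊆ K → x ∈ K → x ∈ D ⊎ x ∈ K ⊕ D
    split D _ x∈K with x ∈? D
    ... | yes x∈D = inj₁ x∈D
    ... | no x∉D  = inj₂ (x∈p⊕q⁺ˡ x∈K x∉D)

  OddCircuit : Subset n → Set
  OddCircuit C = Circuit M C × parity C ≡ true

  oddCircuit? : Decidable OddCircuit
  oddCircuit? C = circuit? C ×-dec (parity C ≟ᵇ true)

  odd-component : ∀ {Z} → ZeroSum M Z → parity Z ≡ true → ∃ λ C → OddCircuit C × C ⊆ Z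
  odd-component zZ oZ with component (λ K → parity K ≟ᵇ true) nonempty split zZ oZ
    where
    nonempty : ∀ {K} → parity K ≡ true → Nonempty K
    nonempty {K} oK = p≢⊥⇒nonempty λ { refl → contradiction (trans (sym (parity-⊥ n)) oK) λ () }
    split : ∀ {K} D → D ⊆ K → parity K ≡ true → parity D ≡ true ⊎ parity (K ⊕ D) ≡ true
    split {K} D _ oK with parity D in oD
    ... | true  = inj₁ refl
    ... | false = inj₂ (trans (parity-⊕ K D) (cong₂ _xor_ oK oD))
  ... | C , CC , C⊆Z , oC = C , (CC , oC) , C⊆Z

  -- A disjoint union is a symmetric difference; this gives the induction principle for cycles.
  cycle-∈ : {P : Subset n → Set} → Subspace P → (∀ C → Circuit M C → P C) → ∀ Z → Cycle M Z → P Z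
  cycle-∈ {P} S PC Z (k , Cs , circ , disj , refl) = go k Cs circ disj
    where
    open Subspace S
    ∈⋃F : ∀ {k} (Cs : Fin k → Subset n) {x} → x ∈ ⋃F Cs → ∃ λ i → x ∈ Cs i
    ∈⋃F {zero}  Cs x∈ = contradiction x∈ ∉⊥
    ∈⋃F {suc k} Cs x∈ with x∈p∪q⁻ (Cs zero) (⋃F (Cs ∘ suc)) x∈
    ... | inj₁ x∈₀ = zero , x∈₀
    ... | inj₂ x∈₁ with ∈⋃F (Cs ∘ suc) x∈₁
    ... | i , x∈ᵢ = suc i , x∈ᵢ
    go : ∀ k (Cs : Fin k → Subset n) → (∀ i → Circuit M (Cs i)) →
         (∀ i j → i ≢ j → Cs i ∩ Cs j ≡ ⊥) → P (⋃F Cs)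
    go zero    Cs circ disj = ⊥-closed
    go (suc k) Cs circ disj = subst P (⊕≡∪ disjoint)
      (⊕-closed (PC (Cs zero) (circ zero)) (go k (Cs ∘ suc) (circ ∘ suc) λ i j i≢j → disj (suc i) (suc j) (i≢j ∘ suc-injective)))
      where
      disjoint : ∀ {x} → x ∈ Cs zero → x ∉ ⋃F (Cs ∘ suc)
      disjoint x∈₀ x∈ with ∈⋃F (Cs ∘ suc) x∈
      ... | i , x∈ᵢ = ∉⊥ (subst (_ ∈_) (disj zero (suc i) λ ()) (x∈p∩q⁺ (x∈₀ , x∈ᵢ)))

  cycle⇒zeroSum : ∀ Z → Cycle M Z → ZeroSum M Z
  cycle⇒zeroSum = cycle-∈ zeroSum-subspace λ C → circuit-zeroSum {C}

  -- Circuits through remaining points are peeled off one at a time; each time the sum with the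
  -- circuit is a smaller zero-sum set disjoint from it.
  zeroSum⇒cycle : ∀ Z → ZeroSum M Z → Cycle M Z
  zeroSum⇒cycle Z zZ = go Z zZ (<-wellFounded ∣ Z ∣)
    where
    Cs⊆⋃F : ∀ {k} (Cs : Fin k → Subset n) i → Cs i ⊆ ⋃F Cs
    Cs⊆⋃F Cs zero    = p⊆p∪q _
    Cs⊆⋃F Cs (suc i) = ⊆-trans (Cs⊆⋃F (Cs ∘ suc) i) (q⊆p∪q (Cs zero) _)
    go : ∀ Z → ZeroSum M Z → Acc _<_ ∣ Z ∣ → Cycle M Z
    go Z zZ (acc rec) with nonempty? Z
    ... | no ¬ne = 0 , (λ ()) , (λ ()) , (λ ()) , Empty-unique ¬ne
    ... | yes (x , x∈Z) with circuit-through zZ x∈Z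
    ... | C , CC , C⊆Z , x∈C
      with go (Z ⊕ C) (zeroSum-⊕ {Z} {C} zZ (circuit-zeroSum {C} CC))
              (rec (p⊂q⇒∣p∣<∣q∣ (p⊕q⊆r ⊆-refl C⊆Z , x , x∈Z , λ x∈ → x∈p⊕q⇒x∉q {p = Z} x∈ x∈Z x∈C)))
    ... | k , Cs , circ , disj , Z⊕C≡ = suc k , extend C Cs , circ′ , disj′ , Z≡
      where
      circ′ : ∀ i → Circuit M (extend C Cs i)
      circ′ zero    = CC
      circ′ (suc i) = circ i
      C-disjoint : ∀ {x} → x ∈ C → x ∉ ⋃F Cs
      C-disjoint x∈C x∈ = x∈p⊕q⇒x∉q {p = Z} (subst (_ ∈_) (sym Z⊕C≡) x∈) (C⊆Z x∈C) x∈C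
      C-∩ : ∀ i → C ∩ Cs i ≡ ⊥
      C-∩ i = Empty-unique λ { (x , x∈) → C-disjoint (proj₁ (x∈p∩q⁻ C (Cs i) x∈)) (Cs⊆⋃F Cs i (proj₂ (x∈p∩q⁻ C (Cs i) x∈))) }
      disj′ : ∀ i j → i ≢ j → extend C Cs i ∩ extend C Cs j ≡ ⊥
      disj′ zero    zero    i≢j = contradiction refl i≢j
      disj′ zero    (suc j) _   = C-∩ j
      disj′ (suc i) zero    _   = trans (∩-comm (Cs i) C) (C-∩ i)
      disj′ (suc i) (suc j) i≢j = disj i j (i≢j ∘ cong suc)
      Z≡ : Z ≡ C ∪ ⋃F Cs
      Z≡ = trans (trans (⊕-solve Z⊕C≡) (⊕-comm (⋃F Cs) C)) (⊕≡∪ C-disjoint)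

  -- Odd circuit bases

  -- What is left of K ⊕ E outside Z is a zero-sum set lying properly inside the circuit E.
  absorb : ∀ {K E Z} → Circuit M E → ZeroSum M K → Meets K E → ZeroSum M Z → Z ⊆ K ⊕ E →
           K ─ E ⊆ Z → Z ≡ K ⊕ E
  absorb {K} {E} {Z} CE zK (x , x∈K , x∈E) zZ Z⊆ K─E⊆Z with nonempty? ((K ⊕ E) ⊕ Z)
  ... | no ¬ne = sym (trans (⊕-solve (Empty-unique ¬ne)) (⊕-identityˡ Z))
  ... | yes ne = contradiction (x∈p⊕q∧x∉q⇒x∈p {p = K ⊕ E} x∈rest λ x∈Z → x∈p⊕q⇒x∉q {p = K} (Z⊆ x∈Z) x∈K x∈E)
                   λ x∈KE → x∈p⊕q⇒x∉q {p = K} x∈KE x∈K x∈E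
    where
    rest⊆E : (K ⊕ E) ⊕ Z ⊆ E
    rest⊆E {y} y∈ with x∈p⊕q⁻ (K ⊕ E) Z y∈
    ... | inj₂ (y∉ , y∈Z) = contradiction (Z⊆ y∈Z) y∉
    ... | inj₁ (y∈KE , y∉Z) with x∈p⊕q⁻ K E y∈KE
    ...   | inj₁ (y∈K , y∉E) = contradiction (K─E⊆Z (x∈p∧x∉q⇒x∈p─q y∈K y∉E)) y∉Z
    ...   | inj₂ (_ , y∈E)   = y∈E
    x∈rest : x ∈ (K ⊕ E) ⊕ Z
    x∈rest = circuit-minimal {E} CE (zeroSum-⊕ {K ⊕ E} {Z} (zeroSum-⊕ {K} {E} zK (circuit-zeroSum {E} CE)) zZ) ne rest⊆E x∈E

  -- Otherwise Z would be a proper part of K.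
  ⊕-component-meets : ∀ {K E Z} → Circuit M K → Meets K E → Circuit M Z → Z ⊆ K ⊕ E → Meets Z E
  ⊕-component-meets {K} {E} {Z} CK (x , x∈K , x∈E) CZ Z⊆ with meets? Z E
  ... | yes m = m
  ... | no ¬m = contradiction (circuit-minimal {K} CK (circuit-zeroSum {Z} CZ) (circuit-nonempty {Z} CZ) Z⊆K x∈K)
                  λ x∈Z → ¬m (x , x∈Z , x∈E)
    where
    Z⊆K : Z ⊆ K
    Z⊆K {y} y∈Z = x∈p⊕q∧x∉q⇒x∈p {p = K} (Z⊆ y∈Z) λ y∈E → ¬m (y , y∈Z , y∈E)

  -- Adding `E` alters `K` only inside `E`; with minimality of `K ─ E` this determines `Z` outside
  -- `E`.
  ─-⊆ : ∀ {K E Z : Subset n} → Z ⊆ K ⊕ E → Z ─ E ⊆ K ─ E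
  ─-⊆ {K} {E} {Z} Z⊆ x∈ with x∈p─q⁻ Z E x∈
  ... | x∈Z , x∉E = x∈p∧x∉q⇒x∈p─q (x∈p⊕q∧x∉q⇒x∈p {p = K} (Z⊆ x∈Z) x∉E) x∉E

  linking-circuit : Connected M → ∀ {C D} → Nonempty C → Nonempty D → ¬ Meets C D →
                    ∃ λ K → Circuit M K × Meets K C × Meets K D
  linking-circuit (_ , conn) (x , x∈C) (y , y∈D) ¬m with conn x y (λ { refl → ¬m (x , x∈C , y∈D) })
  ... | K , CK , x∈K , y∈K = K , CK , (x , x∈K , x∈C) , (y , y∈K , y∈D)

  -- If the given odd circuit `C` misses `E`, a circuit `K` linking them is chosen with `K ─ C`
  -- minimal. Should `K` be even, the circuit of `K ⊕ C` through a point of `K ∩ E` again links `C`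
  -- and `E`, so by minimality it is all of `K ⊕ C`, which is odd.
  odd-circuit-meeting : Connected M → ∃ OddCircuit → ∀ {E} → Circuit M E → ∃ λ K → OddCircuit K × Meets K E
  odd-circuit-meeting conn (C , CC , oC) {E} CE with meets? C E
  ... | yes m = C , (CC , oC) , m
  ... | no ¬m with minimiser (λ K → circuit? K ×-dec (meets? K C ×-dec meets? K E)) (λ K → ∣ K ─ C ∣)
                     (linking-circuit conn (circuit-nonempty {C} CC) (circuit-nonempty {E} CE) ¬m)
  ... | K , (CK , mKC , x , x∈K , x∈E) , min with parity K in oK
  ... | true  = K , (CK , oK) , x , x∈K , x∈E
  ... | false with circuit-through (zeroSum-⊕ {K} {C} (circuit-zeroSum {K} CK) (circuit-zeroSum {C} CC)) (x∈p⊕q⁺ˡ x∈K λ x∈C → ¬m (x , x∈C , x∈E))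
  ... | Z , CZ , Z⊆ , x∈Z = Z , (CZ , trans (cong parity Z≡) (trans (parity-⊕ K C) (cong₂ _xor_ oK oC))) , x , x∈Z , x∈E
    where
    Z≡ : Z ≡ K ⊕ C
    Z≡ = absorb {K} {C} {Z} CC (circuit-zeroSum {K} CK) mKC (circuit-zeroSum {Z} CZ) Z⊆
      (⊆-trans (⊆∧≤⇒⊇ (─-⊆ {K} {C} {Z} Z⊆) (min Z (CZ , ⊕-component-meets {K} {C} {Z} CK mKC CZ Z⊆ , x , x∈Z , x∈E))) (p─q⊆p Z C))

  -- An arbitrary subspace serves two purposes: the span of a family of odd circuits, which yields a
  -- basis, and the kernel of the form.
  oddCircuits-span : Connected M → ∃ OddCircuit → {P : Subset n → Set} → Subspace P →
                     (∀ C → OddCircuit C → P C) → ∀ Z → Cycle M Z → P Z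
  oddCircuits-span conn odd {P} S Podd = cycle-∈ S circuits
    where
    circuits : ∀ E → Circuit M E → P E
    circuits E CE with parity E in oE
    ... | true  = Podd E (CE , oE)
    ... | false with minimiser (λ K → oddCircuit? K ×-dec meets? K E) (λ K → ∣ K ─ E ∣) (odd-circuit-meeting conn odd CE)
    ... | K , ((CK , oK) , mKE) , min
      with odd-component (zeroSum-⊕ {K} {E} (circuit-zeroSum {K} CK) (circuit-zeroSum {E} CE)) (trans (parity-⊕ K E) (cong₂ _xor_ oK oE))
    ... | Z , (CZ , oZ) , Z⊆ = subst P (⊕-cancelˡ K E) (Subspace.⊕-closed S (Podd K (CK , oK)) (subst P Z≡ (Podd Z (CZ , oZ))))
      where
      Z≡ : Z ≡ K ⊕ E
      -- `Z` competes with `K`, being an odd circuit that meets `E`; hence `Z ─ E` cannot be smaller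
      -- than `K ─ E`.
      Z≡ = absorb {K} {E} {Z} CE (circuit-zeroSum {K} CK) mKE (circuit-zeroSum {Z} CZ) Z⊆
        (⊆-trans (⊆∧≤⇒⊇ (─-⊆ {K} {E} {Z} Z⊆) (min Z ((CZ , oZ) , ⊕-component-meets {K} {E} {Z} CK mKE CZ Z⊆))) (p─q⊆p Z E))

  -- An odd circuit can be searched for among the finitely many subsets, so the bare negation yields
  -- a witness.
  ¬bipartite⇒oddCircuit : ¬ Bipartite M → ∃ OddCircuit
  ¬bipartite⇒oddCircuit ¬bip = decidable-stable (anySubset? oddCircuit?) λ none → ¬bip λ C CC → parity⇒even C (even none C CC)
    where
    even : ¬ ∃ OddCircuit → ∀ C → Circuit M C → parity C ≡ false
    even none C CC with parity C in oC
    ... | true  = contradiction (C , CC , oC) none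
    ... | false = refl

  odd-circuit-basis : Connected M → ∃ OddCircuit → ∃ λ k → Σ (Fin k → Subset n) λ B → CircuitBasis M k B × OddCycleBasis M k B
  odd-circuit-basis conn odd with independent-spanning oddCircuit? (allSubsets n)
  ... | k , B , PB , ind , spans = k , B , (basis , proj₁ ∘ PB) , basis , λ i → parity⇒odd (B i) (proj₂ (PB i))
    where
    basis : CycleBasis M k B
    basis = record
      { cycles      = λ i → zeroSum⇒cycle (B i) (circuit-zeroSum {B i} (proj₁ (PB i)))
      ; independent = ind
      ; spanning    = oddCircuits-span conn odd (span-subspace B) λ C → spans C (∈-allSubsets C)
      }

  -- The basis-free condition with which all three statements are compared.
  FormVanishes : Set
  FormVanishes = ∀ C D → Cycle M C → Cycle M D → form C D ≡ false

  -- Bilinear extension from the basis, once in each argument. On the diagonal, where total oddness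
  -- says nothing, the form vanishes because it is alternating.
  totallyOdd⇒formVanishes : HasTotallyOddCircuitBasis M → FormVanishes
  totallyOdd⇒formVanishes (k , B , _ , (basis , odd) , inter) C D cC cD
    with CycleBasis.spanning basis C cC | CycleBasis.spanning basis D cD
  ... | c , refl | d , refl = lincomb-∈ (form-kernel (lincomb B c)) B
    (λ j → trans (form-comm (lincomb B c) (B j)) (lincomb-∈ (form-kernel (B j)) B (form-B j) c)) d
    where
    form-B : ∀ i j → form (B i) (B j) ≡ false
    form-B i j with i ≟ᶠ j
    ... | yes refl = form-self (B i)
    ... | no i≢j   = odd-∩⇒form≡false {p = B i} {q = B j} (odd i) (odd j) (inter i j i≢j)

  formVanishes⇒totallyOdd : FormVanishes → EveryOddCycleBasisTotallyOdd M
  formVanishes⇒totallyOdd vanish k B (basis , odd) = (basis , odd) ,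
    λ i j _ → form≡false⇒odd-∩ {p = B i} {q = B j} (odd i) (odd j) (vanish (B i) (B j) (cycles i) (cycles j))
    where open CycleBasis basis

-- Set difference

─-distribʳ-⊕ : (p q r : Subset n) → (p ⊕ q) ─ r ≡ (p ─ r) ⊕ (q ─ r)
─-distribʳ-⊕ []      []      []          = refl
─-distribʳ-⊕ (a ∷ p) (b ∷ q) (true  ∷ r) = cong (false ∷_) (─-distribʳ-⊕ p q r)
─-distribʳ-⊕ (a ∷ p) (b ∷ q) (false ∷ r) = cong ((a xor b) ∷_) (─-distribʳ-⊕ p q r)

─⊕∩ : (p q : Subset n) → (p ─ q) ⊕ (p ∩ q) ≡ p
─⊕∩ []          []          = refl
─⊕∩ (true  ∷ p) (true  ∷ q) = cong (true ∷_)  (─⊕∩ p q)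
─⊕∩ (true  ∷ p) (false ∷ q) = cong (true ∷_)  (─⊕∩ p q)
─⊕∩ (false ∷ p) (true  ∷ q) = cong (false ∷_) (─⊕∩ p q)
─⊕∩ (false ∷ p) (false ∷ q) = cong (false ∷_) (─⊕∩ p q)

disjoint⇒─≡ : ¬ Meets p q → p ─ q ≡ p
disjoint⇒─≡ {p = p} {q = q} ¬m = ⊆-antisym (p─q⊆p p q) λ {x} x∈p → x∈p∧x∉q⇒x∈p─q x∈p λ x∈q → ¬m (x , x∈p , x∈q)

parity-─∩ : (p q : Subset n) → parity (p ─ q) xor parity (p ∩ q) ≡ parity p
parity-─∩ p q = trans (sym (parity-⊕ (p ─ q) (p ∩ q))) (cong parity (─⊕∩ p q))

-- Thetas

module _ {n : ℕ} (M : BinMatroid n) where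
  open Matroid M

  -- The restriction of M to P ∪ Q ∪ R is the circuit matroid of a subdivision of three
  -- parallel edges, whose paths are P, Q and R.
  record Theta (P Q R : Subset n) : Set where
    field
      P#Q : ∀ {x} → x ∈ P → x ∉ Q
      P#R : ∀ {x} → x ∈ P → x ∉ R
      Q#R : ∀ {x} → x ∈ Q → x ∉ R
      P-nonempty : Nonempty P
      Q-nonempty : Nonempty Q
      R-nonempty : Nonempty R
      P⊕Q-zeroSum : ZeroSum M (P ⊕ Q)
      P⊕R-zeroSum : ZeroSum M (P ⊕ R)
      zeroSum-cases : ∀ {Z} → ZeroSum M Z → (∀ {x} → x ∈ Z → x ∈ P ⊎ x ∈ Q ⊎ x ∈ R) →
                      Z ≡ ⊥ ⊎ Z ≡ P ⊕ Q ⊎ Z ≡ P ⊕ R ⊎ Z ≡ Q ⊕ R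

  -- The even path is nonempty, so it splits into two odd ones; the odd paths `P` and `Q` subdivide
  -- the doubled edge of C₃⁺.
  OddTheta : Set
  OddTheta = ∃ λ P → ∃ λ Q → ∃ λ R → Theta P Q R × parity P ≡ true × parity Q ≡ true × parity R ≡ false

  theta-swap : ∀ {P Q R} → Theta P Q R → Theta Q P R
  theta-swap {P} {Q} {R} θ = record
    { P#Q = λ x∈Q x∈P → P#Q x∈P x∈Q
    ; P#R = Q#R
    ; Q#R = P#R
    ; P-nonempty = Q-nonempty
    ; Q-nonempty = P-nonempty
    ; R-nonempty = R-nonempty
    ; P⊕Q-zeroSum = subst (ZeroSum M) (⊕-comm P Q) P⊕Q-zeroSum
    ; P⊕R-zeroSum = subst (ZeroSum M) Q⊕R≡ (zeroSum-⊕ {P ⊕ Q} {P ⊕ R} P⊕Q-zeroSum P⊕R-zeroSum)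
    ; zeroSum-cases = λ zZ Z⊆ → reorder (zeroSum-cases zZ (λ x∈ → reorder⊎ (Z⊆ x∈)))
    }
    where
    open Theta θ
    Q⊕R≡ : (P ⊕ Q) ⊕ (P ⊕ R) ≡ Q ⊕ R
    Q⊕R≡ = trans (⊕-interchange P Q P R) (trans (cong (_⊕ (Q ⊕ R)) (⊕-self P)) (⊕-identityˡ (Q ⊕ R)))
    reorder⊎ : ∀ {A B C : Set} → A ⊎ B ⊎ C → B ⊎ A ⊎ C
    reorder⊎ (inj₁ a)        = inj₂ (inj₁ a)
    reorder⊎ (inj₂ (inj₁ b)) = inj₁ b
    reorder⊎ (inj₂ (inj₂ c)) = inj₂ (inj₂ c)
    reorder : ∀ {Z} → Z ≡ ⊥ ⊎ Z ≡ P ⊕ Q ⊎ Z ≡ P ⊕ R ⊎ Z ≡ Q ⊕ R → Z ≡ ⊥ ⊎ Z ≡ Q ⊕ P ⊎ Z ≡ Q ⊕ R ⊎ Z ≡ P ⊕ R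
    reorder (inj₁ e)               = inj₁ e
    reorder (inj₂ (inj₁ e))        = inj₂ (inj₁ (trans e (⊕-comm P Q)))
    reorder (inj₂ (inj₂ (inj₁ e))) = inj₂ (inj₂ (inj₂ e))
    reorder (inj₂ (inj₂ (inj₂ e))) = inj₂ (inj₂ (inj₁ e))

  theta-swapʳ : ∀ {P Q R} → Theta P Q R → Theta P R Q
  theta-swapʳ {P} {Q} {R} θ = record
    { P#Q = P#R
    ; P#R = P#Q
    ; Q#R = λ x∈R x∈Q → Q#R x∈Q x∈R
    ; P-nonempty = P-nonempty
    ; Q-nonempty = R-nonempty
    ; R-nonempty = Q-nonempty
    ; P⊕Q-zeroSum = P⊕R-zeroSum
    ; P⊕R-zeroSum = P⊕Q-zeroSum
    ; zeroSum-cases = λ zZ Z⊆ → reorder (zeroSum-cases zZ (λ x∈ → reorder⊎ (Z⊆ x∈)))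
    }
    where
    open Theta θ
    reorder⊎ : ∀ {A B C : Set} → A ⊎ B ⊎ C → A ⊎ C ⊎ B
    reorder⊎ (inj₁ a)        = inj₁ a
    reorder⊎ (inj₂ (inj₁ b)) = inj₂ (inj₂ b)
    reorder⊎ (inj₂ (inj₂ c)) = inj₂ (inj₁ c)
    reorder : ∀ {Z} → Z ≡ ⊥ ⊎ Z ≡ P ⊕ Q ⊎ Z ≡ P ⊕ R ⊎ Z ≡ Q ⊕ R → Z ≡ ⊥ ⊎ Z ≡ P ⊕ R ⊎ Z ≡ P ⊕ Q ⊎ Z ≡ R ⊕ Q
    reorder (inj₁ e)               = inj₁ e
    reorder (inj₂ (inj₁ e))        = inj₂ (inj₂ (inj₁ e))
    reorder (inj₂ (inj₂ (inj₁ e))) = inj₂ (inj₁ e)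
    reorder (inj₂ (inj₂ (inj₂ e))) = inj₂ (inj₂ (inj₂ (trans e (⊕-comm Q R))))

  -- The other two nonzero zero-sum sets contain the nonempty `R`, so neither fits inside `P ⊕ Q`.
  theta-circuit : ∀ {P Q R} → Theta P Q R → Circuit M (P ⊕ Q)
  theta-circuit {P} {Q} {R} θ = mkCircuit P⊕Q-zeroSum
    (proj₁ P-nonempty , x∈p⊕q⁺ˡ (proj₂ P-nonempty) (P#Q (proj₂ P-nonempty))) minimal
    where
    open Theta θ
    R-avoids : ∀ {D S} → (∀ {x} → x ∈ S → x ∉ R) → D ≡ S ⊕ R → ¬ (D ⊆ P ⊕ Q)
    R-avoids S#R refl D⊆ with R-nonempty
    ... | x , x∈R with x∈p⊕q⁻ P Q (D⊆ (x∈p⊕q⁺ʳ (λ x∈S → S#R x∈S x∈R) x∈R))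
    ...   | inj₁ (x∈P , _) = P#R x∈P x∈R
    ...   | inj₂ (_ , x∈Q) = Q#R x∈Q x∈R
    minimal : ∀ {D} → ZeroSum M D → Nonempty D → D ⊆ P ⊕ Q → P ⊕ Q ⊆ D
    minimal {D} zD neD D⊆ with zeroSum-cases zD (λ x∈ → covered (x∈p⊕q⁻ P Q (D⊆ x∈)))
      where
      covered : ∀ {x} → (x ∈ P × x ∉ Q) ⊎ (x ∉ P × x ∈ Q) → x ∈ P ⊎ x ∈ Q ⊎ x ∈ R
      covered (inj₁ (x∈P , _)) = inj₁ x∈P
      covered (inj₂ (_ , x∈Q)) = inj₂ (inj₁ x∈Q)
    ... | inj₁ D≡⊥                = contradiction D≡⊥ (nonempty⇒p≢⊥ neD)
    ... | inj₂ (inj₁ refl)        = λ x∈ → x∈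
    ... | inj₂ (inj₂ (inj₁ D≡))   = contradiction (λ {x} → D⊆ {x}) (R-avoids P#R D≡)
    ... | inj₂ (inj₂ (inj₂ D≡))   = contradiction (λ {x} → D⊆ {x}) (R-avoids Q#R D≡)

  Spanned : Subset n → Subset n → Set
  Spanned X Y = ∀ {Z} → ZeroSum M Z → (∀ {x} → x ∈ Z → x ∈ X ⊎ x ∈ Y) → Z ≡ ⊥ ⊎ Z ≡ X ⊎ Z ≡ Y ⊎ Z ≡ X ⊕ Y

  -- The cycles `X`, `Y` and `X ⊕ Y` are the unions of two of the three paths.
  spanned⇒theta : ∀ {X Y} → ZeroSum M X → ZeroSum M Y → Nonempty (X ─ Y) → Nonempty (Y ─ X) → Meets X Y →
                  Spanned X Y → Theta (X ─ Y) (Y ─ X) (X ∩ Y)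
  spanned⇒theta {X} {Y} zX zY neX neY (y , y∈X , y∈Y) cases = record
    { P#Q = λ x∈ x∈′ → proj₂ (x∈p─q⁻ Y X x∈′) (p─q⊆p X Y x∈)
    ; P#R = λ x∈ x∈′ → proj₂ (x∈p─q⁻ X Y x∈) (p∩q⊆q X Y x∈′)
    ; Q#R = λ x∈ x∈′ → proj₂ (x∈p─q⁻ Y X x∈) (p∩q⊆p X Y x∈′)
    ; P-nonempty = neX
    ; Q-nonempty = neY
    ; R-nonempty = y , x∈p∩q⁺ (y∈X , y∈Y)
    ; P⊕Q-zeroSum = subst (ZeroSum M) (sym PQ≡) (zeroSum-⊕ {X} {Y} zX zY)
    ; P⊕R-zeroSum = subst (ZeroSum M) (sym PR≡) zX
    ; zeroSum-cases = λ zZ Z⊆ → reorder (cases zZ (λ x∈ → covered (Z⊆ x∈)))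
    }
    where
    PR≡ : (X ─ Y) ⊕ (X ∩ Y) ≡ X
    PR≡ = ─⊕∩ X Y
    QR≡ : (Y ─ X) ⊕ (X ∩ Y) ≡ Y
    QR≡ = trans (cong ((Y ─ X) ⊕_) (∩-comm X Y)) (─⊕∩ Y X)
    PQ≡ : (X ─ Y) ⊕ (Y ─ X) ≡ X ⊕ Y
    PQ≡ = begin
      (X ─ Y) ⊕ (Y ─ X)                              ≡⟨ ⊕-identityʳ _ ⟨
      ((X ─ Y) ⊕ (Y ─ X)) ⊕ ⊥                        ≡⟨ cong (((X ─ Y) ⊕ (Y ─ X)) ⊕_) (⊕-self (X ∩ Y)) ⟨
      ((X ─ Y) ⊕ (Y ─ X)) ⊕ ((X ∩ Y) ⊕ (X ∩ Y))      ≡⟨ ⊕-interchange (X ─ Y) (Y ─ X) (X ∩ Y) (X ∩ Y) ⟩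
      ((X ─ Y) ⊕ (X ∩ Y)) ⊕ ((Y ─ X) ⊕ (X ∩ Y))      ≡⟨ cong₂ _⊕_ PR≡ QR≡ ⟩
      X ⊕ Y                                          ∎
      where open ≡-Reasoning
    covered : ∀ {x} → x ∈ X ─ Y ⊎ x ∈ Y ─ X ⊎ x ∈ X ∩ Y → x ∈ X ⊎ x ∈ Y
    covered (inj₁ x∈)        = inj₁ (p─q⊆p X Y x∈)
    covered (inj₂ (inj₁ x∈)) = inj₂ (p─q⊆p Y X x∈)
    covered (inj₂ (inj₂ x∈)) = inj₁ (p∩q⊆p X Y x∈)
    reorder : ∀ {Z} → Z ≡ ⊥ ⊎ Z ≡ X ⊎ Z ≡ Y ⊎ Z ≡ X ⊕ Y →
              Z ≡ ⊥ ⊎ Z ≡ (X ─ Y) ⊕ (Y ─ X) ⊎ Z ≡ (X ─ Y) ⊕ (X ∩ Y) ⊎ Z ≡ (Y ─ X) ⊕ (X ∩ Y)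
    reorder (inj₁ e)               = inj₁ e
    reorder (inj₂ (inj₁ e))        = inj₂ (inj₂ (inj₁ (trans e (sym PR≡))))
    reorder (inj₂ (inj₂ (inj₁ e))) = inj₂ (inj₂ (inj₂ (trans e (sym QR≡))))
    reorder (inj₂ (inj₂ (inj₂ e))) = inj₂ (inj₁ (trans e (sym PQ≡)))

  -- As `X` is odd, exactly one of `X ─ Y` and `X ∩ Y` is odd. That one is paired with `Y ─ X`, and
  -- the other becomes the even path.
  spanned⇒oddTheta : ∀ {X Y} → ZeroSum M X → ZeroSum M Y → Nonempty (X ─ Y) → Meets X Y → Spanned X Y →
                     parity X ≡ true → parity (Y ─ X) ≡ true → OddTheta
  spanned⇒oddTheta {X} {Y} zX zY neX mXY cases oX oY─X = byParity (parity (X ─ Y)) (parity (X ∩ Y)) refl refl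
    where
    θ : Theta (X ─ Y) (Y ─ X) (X ∩ Y)
    θ = spanned⇒theta {X} {Y} zX zY neX (p≢⊥⇒nonempty λ e → contradiction (trans (sym (parity-⊥ n)) (trans (cong parity (sym e)) oY─X)) λ ()) mXY cases
    byParity : ∀ a b → parity (X ─ Y) ≡ a → parity (X ∩ Y) ≡ b → OddTheta
    byParity true  false ea eb = X ─ Y , Y ─ X , X ∩ Y , θ , ea , oY─X , eb
    byParity false true  ea eb = X ∩ Y , Y ─ X , X ─ Y , theta-swapʳ (theta-swap (theta-swapʳ θ)) , eb , oY─X , ea
    byParity true  true  ea eb = contradiction (trans (sym oX) (trans (sym (parity-─∩ X Y)) (cong₂ _xor_ ea eb))) λ ()
    byParity false false ea eb = contradiction (trans (sym oX) (trans (sym (parity-─∩ X Y)) (cong₂ _xor_ ea eb))) λ ()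

  zeroSum-⊆-circuit : ∀ {C Z} → Circuit M C → ZeroSum M Z → Z ⊆ C → Z ≡ ⊥ ⊎ Z ≡ C
  zeroSum-⊆-circuit {C} {Z} CC zZ Z⊆C with nonempty? Z
  ... | no ¬ne = inj₁ (Empty-unique ¬ne)
  ... | yes ne = inj₂ (⊆-antisym Z⊆C (circuit-minimal {C} CC zZ ne Z⊆C))

  -- K links C and D with as few further elements as possible.  Then both K and K ⊕ C form a
  -- theta with D; the paths outside D of these two thetas have different parities.
  disjoint⇒oddTheta : Connected M → ∀ {C D} → OddCircuit C → OddCircuit D → ¬ Meets C D → Spanned C D → OddTheta
  disjoint⇒oddTheta conn {C} {D} (CC , oC) (CD , oD) ¬m cases
    with minimiser (λ K → circuit? K ×-dec (meets? K C ×-dec meets? K D)) (λ K → ∣ K ─ (C ∪ D) ∣)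
           (linking-circuit conn (circuit-nonempty {C} CC) (circuit-nonempty {D} CD) ¬m)
  ... | K , (CK , (x , x∈K , x∈C) , (y , y∈K , y∈D)) , min = choose (parity (K ─ D)) refl
    where
    zC : ZeroSum M C
    zC = circuit-zeroSum {C} CC
    zK : ZeroSum M K
    zK = circuit-zeroSum {K} CK
    C#D : ∀ {z} → z ∈ C → z ∉ D
    C#D z∈C z∈D = ¬m (_ , z∈C , z∈D)

    not-both : ∀ {Z} → Circuit M Z → Z ─ (C ∪ D) ⊂ K ─ (C ∪ D) → Meets Z C → ¬ Meets Z D
    not-both {Z} CZ Z⊂ mC mD = <⇒≱ (p⊂q⇒∣p∣<∣q∣ Z⊂) (min Z (CZ , mC , mD))

    outer-∈K : ∀ {Z z} → Z ⊆ (C ∪ D) ∪ K → z ∈ Z → z ∉ C ∪ D → z ∈ K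
    outer-∈K Z⊆ z∈Z z∉ with x∈p∪q⁻ (C ∪ D) K (Z⊆ z∈Z)
    ... | inj₁ z∈  = contradiction z∈ z∉
    ... | inj₂ z∈K = z∈K

    -- The circuit of K ⊕ Z through a point of K ∩ B would be a proper part of K.
    one-sided : ∀ {A B Z z} → (∀ {w} → w ∈ C ∪ D → w ∈ A ⊎ w ∈ B) → Meets K A → Meets K B →
                (∀ {K₁} → Circuit M K₁ → K₁ ─ (C ∪ D) ⊂ K ─ (C ∪ D) → Meets K₁ A → ¬ Meets K₁ B) →
                ZeroSum M Z → Z ⊆ (C ∪ D) ∪ K → z ∈ Z → z ∉ C ∪ D → Meets Z B
    one-sided {A} {B} {Z} {z} cover (a , a∈K , a∈A) (b , b∈K , b∈B) excl zZ Z⊆ z∈Z z∉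
      with meets? Z B
    ... | yes m = m
    ... | no ¬mB with circuit-through (zeroSum-⊕ {K} {Z} zK zZ) (x∈p⊕q⁺ˡ b∈K λ b∈Z → ¬mB (b , b∈Z , b∈B))
    -- `K₁` misses the outer point `z` of `K`, so it cannot meet both `A` and `B`. Since it meets
    -- `B` it avoids `A`, which confines it to `K`; but then it is all of `K` and meets `A` after
    -- all.
    ... | K₁ , CK₁ , K₁⊆ , b∈K₁ = contradiction (b , b∈K₁ , b∈B)
      (excl {K₁} CK₁ K₁⊂ (a , circuit-minimal {K} CK (circuit-zeroSum {K₁} CK₁) (b , b∈K₁) K₁⊆K a∈K , a∈A))
      where
      z∈K : z ∈ K
      z∈K = outer-∈K Z⊆ z∈Z z∉
      K₁⊂ : K₁ ─ (C ∪ D) ⊂ K ─ (C ∪ D)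
      K₁⊂ = inner , z , x∈p∧x∉q⇒x∈p─q z∈K z∉ , λ z∈ → x∈p⊕q⇒x∉q {p = K} (K₁⊆ (p─q⊆p K₁ _ z∈)) z∈K z∈Z
        where
        inner : K₁ ─ (C ∪ D) ⊆ K ─ (C ∪ D)
        inner w∈ with x∈p─q⁻ K₁ (C ∪ D) w∈
        ... | w∈K₁ , w∉ with x∈p⊕q⁻ K Z (K₁⊆ w∈K₁)
        ...   | inj₁ (w∈K , _) = x∈p∧x∉q⇒x∈p─q w∈K w∉
        ...   | inj₂ (_ , w∈Z) = x∈p∧x∉q⇒x∈p─q (outer-∈K Z⊆ w∈Z w∉) w∉
      K₁⊆K : K₁ ⊆ K
      K₁⊆K {w} w∈K₁ with x∈p⊕q⁻ K Z (K₁⊆ w∈K₁)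
      ... | inj₁ (w∈K , _) = w∈K
      ... | inj₂ (_ , w∈Z) with x∈p∪q⁻ (C ∪ D) K (Z⊆ w∈Z)
      ...   | inj₂ w∈K = w∈K
      ...   | inj₁ w∈ with cover w∈
      ...     | inj₁ w∈A = contradiction (b , b∈K₁ , b∈B) (excl {K₁} CK₁ K₁⊂ (w , w∈K₁ , w∈A))
      ...     | inj₂ w∈B = contradiction (w , w∈Z , w∈B) ¬mB

    -- The outer points of `K` come all or none: a circuit that contains some but not all of them
    -- would, by `one-sided`, meet both `C` and `D` and so beat `K`.
    dichotomy : ∀ {Z} → ZeroSum M Z → Z ⊆ (C ∪ D) ∪ K → Z ⊆ C ∪ D ⊎ K ─ (C ∪ D) ⊆ Z
    dichotomy {Z} zZ Z⊆ with ⊆-or-witness Z (C ∪ D) | ⊆-or-witness (K ─ (C ∪ D)) Z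
    ... | inj₁ Z⊆CD             | _                  = inj₁ Z⊆CD
    ... | inj₂ _                | inj₁ outer⊆        = inj₂ outer⊆
    ... | inj₂ (z , z∈Z , z∉) | inj₂ (w , w∈ , w∉Z) with circuit-through zZ z∈Z
    ... | Z₁ , CZ₁ , Z₁⊆Z , z∈Z₁ = contradiction meetsD (not-both {Z₁} CZ₁ Z₁⊂ meetsC)
      where
      Z₁⊆ : Z₁ ⊆ (C ∪ D) ∪ K
      Z₁⊆ = ⊆-trans Z₁⊆Z Z⊆
      Z₁⊂ : Z₁ ─ (C ∪ D) ⊂ K ─ (C ∪ D)
      Z₁⊂ = (λ v∈ → let v∈Z₁ , v∉ = x∈p─q⁻ Z₁ (C ∪ D) v∈ in x∈p∧x∉q⇒x∈p─q (outer-∈K Z₁⊆ v∈Z₁ v∉) v∉)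
          , w , w∈ , λ w∈′ → w∉Z (Z₁⊆Z (p─q⊆p Z₁ _ w∈′))
      meetsD : Meets Z₁ D
      meetsD = one-sided {C} {D} (x∈p∪q⁻ C D) (x , x∈K , x∈C) (y , y∈K , y∈D) not-both
                 (circuit-zeroSum {Z₁} CZ₁) Z₁⊆ z∈Z₁ z∉
      meetsC : Meets Z₁ C
      meetsC = one-sided {D} {C} (swap ∘ x∈p∪q⁻ C D) (y , y∈K , y∈D) (x , x∈K , x∈C)
                 (λ {K₁} CK₁ K₁⊂ mD mC → not-both {K₁} CK₁ K₁⊂ mC mD) (circuit-zeroSum {Z₁} CZ₁) Z₁⊆ z∈Z₁ z∉

    -- `K₂` stands for `K` or `K ⊕ C`. By `dichotomy` a zero-sum set inside `D ∪ K₂` lies in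
    -- `C ∪ D`, possibly after adding `K₂`. There the only candidates are the four known sets, and
    -- those containing `C` drop out because `C` avoids `D` and is not inside `K₂`.
    theta-with-D : ∀ {K₂} → ZeroSum M K₂ → K₂ ⊆ (C ∪ D) ∪ K → K ─ (C ∪ D) ⊆ K₂ → ¬ (C ⊆ K₂) →
                   Meets D K₂ → Nonempty (D ─ K₂) → parity (K₂ ─ D) ≡ true → OddTheta
    theta-with-D {K₂} zK₂ K₂⊆ outer⊆ C⊈K₂ mD neD oK₂ =
      spanned⇒oddTheta {D} {K₂} (circuit-zeroSum {D} CD) zK₂ neD mD spanned oD oK₂
      where
      C-missing : ∀ {W} → (∀ {w} → w ∈ W → w ∈ D ⊎ w ∈ K₂) → ¬ (C ⊆ W)
      C-missing W⊆ C⊆W = C⊈K₂ λ {w} w∈C → [D] w∈C (W⊆ (C⊆W w∈C))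
        where
        [D] : ∀ {w} → w ∈ C → w ∈ D ⊎ w ∈ K₂ → w ∈ K₂
        [D] w∈C (inj₁ w∈D)  = contradiction w∈D (C#D w∈C)
        [D] w∈C (inj₂ w∈K₂) = w∈K₂
      inner-cases : ∀ {W} → ZeroSum M W → W ⊆ C ∪ D → (∀ {w} → w ∈ W → w ∈ D ⊎ w ∈ K₂) → W ≡ ⊥ ⊎ W ≡ D
      inner-cases {W} zW W⊆CD W⊆ with cases zW (λ w∈ → x∈p∪q⁻ C D (W⊆CD w∈))
      ... | inj₁ e                  = inj₁ e
      ... | inj₂ (inj₁ refl)        = contradiction (λ {w} (w∈ : w ∈ W) → w∈) (C-missing W⊆)
      ... | inj₂ (inj₂ (inj₁ e))    = inj₂ e
      ... | inj₂ (inj₂ (inj₂ refl)) = contradiction (λ {w} (w∈C : w ∈ C) → x∈p⊕q⁺ˡ w∈C (C#D w∈C)) (C-missing W⊆)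
      spanned : Spanned D K₂
      spanned {Z} zZ Z⊆ with dichotomy zZ (λ z∈ → widen (Z⊆ z∈))
        where
        widen : ∀ {z} → z ∈ D ⊎ z ∈ K₂ → z ∈ (C ∪ D) ∪ K
        widen (inj₁ z∈D)  = p⊆p∪q K (q⊆p∪q C D z∈D)
        widen (inj₂ z∈K₂) = K₂⊆ z∈K₂
      ... | inj₁ Z⊆CD with inner-cases zZ Z⊆CD Z⊆
      ...   | inj₁ e = inj₁ e
      ...   | inj₂ e = inj₂ (inj₁ e)
      spanned {Z} zZ Z⊆ | inj₂ outer⊆Z with inner-cases (zeroSum-⊕ {Z} {K₂} zZ zK₂) rest⊆CD rest⊆
        where
        rest⊆ : ∀ {w} → w ∈ Z ⊕ K₂ → w ∈ D ⊎ w ∈ K₂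
        rest⊆ w∈ with x∈p⊕q⁻ Z K₂ w∈
        ... | inj₁ (w∈Z , _)  = Z⊆ w∈Z
        ... | inj₂ (_ , w∈K₂) = inj₂ w∈K₂
        rest⊆CD : Z ⊕ K₂ ⊆ C ∪ D
        rest⊆CD {w} w∈ = decidable-stable (w ∈? (C ∪ D)) λ w∉ → impossible w∉ (x∈p⊕q⁻ Z K₂ w∈)
          where
          impossible : w ∉ C ∪ D → ¬ ((w ∈ Z × w ∉ K₂) ⊎ (w ∉ Z × w ∈ K₂))
          impossible w∉ (inj₂ (w∉Z , w∈K₂)) = w∉Z (outer⊆Z (x∈p∧x∉q⇒x∈p─q (outer-∈K K₂⊆ w∈K₂ w∉) w∉))
          impossible w∉ (inj₁ (w∈Z , w∉K₂)) with Z⊆ w∈Z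
          ... | inj₁ w∈D  = w∉ (q⊆p∪q C D w∈D)
          ... | inj₂ w∈K₂ = w∉K₂ w∈K₂
      ... | inj₁ e = inj₂ (inj₂ (inj₁ (trans (⊕-solve e) (⊕-identityˡ K₂))))
      ... | inj₂ e = inj₂ (inj₂ (inj₂ (⊕-solve e)))

    D─K-nonempty : Nonempty (D ─ K)
    D─K-nonempty with ⊆-or-witness D K
    ... | inj₁ D⊆K = contradiction (circuit-minimal {K} CK (circuit-zeroSum {D} CD) (circuit-nonempty {D} CD) D⊆K x∈K) (C#D x∈C)
    ... | inj₂ (z , z∈D , z∉K) = z , x∈p∧x∉q⇒x∈p─q z∈D z∉K

    choose : ∀ b → parity (K ─ D) ≡ b → OddTheta
    choose true oK = theta-with-D {K} zK (q⊆p∪q (C ∪ D) K) (p─q⊆p K _) C⊈K (y , y∈D , y∈K) D─K-nonempty oK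
      where
      C⊈K : ¬ (C ⊆ K)
      C⊈K C⊆K = C#D (circuit-minimal {K} CK zC (circuit-nonempty {C} CC) C⊆K y∈K) y∈D
    choose false oK = theta-with-D {K ⊕ C} (zeroSum-⊕ {K} {C} zK zC)
        (p⊕q⊆r (q⊆p∪q (C ∪ D) K) (⊆-trans (p⊆p∪q D) (p⊆p∪q K)))
        (λ z∈ → let z∈K , z∉ = x∈p─q⁻ K (C ∪ D) z∈ in x∈p⊕q⁺ˡ z∈K (z∉ ∘ p⊆p∪q D))
        (λ C⊆ → x∈p⊕q⇒x∉q {p = K} (C⊆ x∈C) x∈K x∈C)
        (y , y∈D , x∈p⊕q⁺ˡ y∈K λ y∈C → C#D y∈C y∈D)
        nonempty parity≡
      where
      nonempty : Nonempty (D ─ (K ⊕ C))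
      nonempty with D─K-nonempty
      ... | z , z∈ with x∈p─q⁻ D K z∈
      ...   | z∈D , z∉K = z , x∈p∧x∉q⇒x∈p─q z∈D λ z∈′ → C#D (x∈p⊕q∧x∉p⇒x∈q {p = K} z∈′ z∉K) z∈D
      -- `C` is odd and lies outside `D`, so adding it flips the parity there.
      parity≡ : parity ((K ⊕ C) ─ D) ≡ true
      parity≡ = trans (cong parity (─-distribʳ-⊕ K C D)) (trans (parity-⊕ (K ─ D) (C ─ D))
        (cong₂ _xor_ oK (trans (cong parity (disjoint⇒─≡ ¬m)) oC)))

  ¬oddTheta⇒form≡false : Connected M → ¬ OddTheta → ∀ {C} → OddCircuit C → ∀ D → ZeroSum M D → form C D ≡ false
  ¬oddTheta⇒form≡false conn ¬θ {C} (CC , oC) D zD = go D zD (<-wellFounded ∣ D ─ C ∣)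
    where
    zC : ZeroSum M C
    zC = circuit-zeroSum {C} CC
    Splitting : Subset n → Subset n → Set
    Splitting D Z = ZeroSum M Z × Nonempty (Z ─ C) × Z ─ C ⊂ D ─ C

    -- A zero-sum set `Z` inside `C ∪ D` but not inside `C` must contain all of `D ─ C`, or it would
    -- split `D`. Then `Z ⊕ D` lies in the circuit `C`.
    spanned : ∀ {D} → ZeroSum M D → ¬ ∃ (Splitting D) → Spanned C D
    spanned {D} zD none {Z} zZ Z⊆ with ⊆-or-witness Z C
    ... | inj₁ Z⊆C with zeroSum-⊆-circuit {C} CC zZ Z⊆C
    ...   | inj₁ e = inj₁ e
    ...   | inj₂ e = inj₂ (inj₁ e)
    spanned {D} zD none {Z} zZ Z⊆ | inj₂ (z , z∈Z , z∉C)
      with zeroSum-⊆-circuit {C} CC (zeroSum-⊕ {Z} {D} zZ zD) rest⊆C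
      where
      Z∈D : ∀ {x} → x ∈ Z → x ∉ C → x ∈ D
      Z∈D x∈Z x∉C with Z⊆ x∈Z
      ... | inj₁ x∈C = contradiction x∈C x∉C
      ... | inj₂ x∈D = x∈D
      D─C⊆Z─C : D ─ C ⊆ Z ─ C
      D─C⊆Z─C with ⊆-or-witness (D ─ C) (Z ─ C)
      ... | inj₁ ⊆Z = ⊆Z
      ... | inj₂ w  = ⊥-elim (none (Z , zZ , (z , x∈p∧x∉q⇒x∈p─q z∈Z z∉C)
                        , (λ x∈ → let x∈Z , x∉C = x∈p─q⁻ Z C x∈ in x∈p∧x∉q⇒x∈p─q (Z∈D x∈Z x∉C) x∉C) , w))
      rest⊆C : Z ⊕ D ⊆ C
      rest⊆C {x} x∈ = decidable-stable (x ∈? C) λ x∉C → impossible x∉C (x∈p⊕q⁻ Z D x∈)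
        where
        impossible : x ∉ C → ¬ ((x ∈ Z × x ∉ D) ⊎ (x ∉ Z × x ∈ D))
        impossible x∉C (inj₁ (x∈Z , x∉D)) = x∉D (Z∈D x∈Z x∉C)
        impossible x∉C (inj₂ (x∉Z , x∈D)) = x∉Z (p─q⊆p Z C (D─C⊆Z─C (x∈p∧x∉q⇒x∈p─q x∈D x∉C)))
    ... | inj₁ e = inj₂ (inj₂ (inj₁ (trans (⊕-solve e) (⊕-identityˡ D))))
    ... | inj₂ e = inj₂ (inj₂ (inj₂ (⊕-solve e)))

    -- Here the form is the parity of `D`. An odd `D` would be a circuit, since the remaining
    -- nonzero sets `C` and `C ⊕ D` both contain `C`.
    disjoint : ∀ D → ZeroSum M D → Nonempty D → ¬ Meets C D → Spanned C D → form C D ≡ false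
    disjoint D zD neD ¬m cases with parity D in oD
    ... | true  = contradiction (disjoint⇒oddTheta conn {C} {D} (CC , oC) (mkCircuit {D} zD neD minimal , oD) ¬m cases) ¬θ
      where
      C⊈D : ¬ (C ⊆ D)
      C⊈D C⊆D with circuit-nonempty {C} CC
      ... | c , c∈C = ¬m (c , c∈C , C⊆D c∈C)
      minimal : ∀ {E} → ZeroSum M E → Nonempty E → E ⊆ D → D ⊆ E
      minimal zE neE E⊆D with cases zE (inj₂ ∘ E⊆D)
      ... | inj₁ e                  = contradiction e (nonempty⇒p≢⊥ neE)
      ... | inj₂ (inj₁ refl)        = contradiction (λ {x} → E⊆D {x}) C⊈D
      ... | inj₂ (inj₂ (inj₁ refl)) = λ x∈ → x∈
      ... | inj₂ (inj₂ (inj₂ refl)) = contradiction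
              (λ {x} (x∈C : x ∈ C) → E⊆D (x∈p⊕q⁺ˡ x∈C λ x∈D → ¬m (x , x∈C , x∈D))) C⊈D
    ... | false = cong₂ _xor_ (dot-disjoint {p = C} {q = D} λ x∈C x∈D → ¬m (_ , x∈C , x∈D)) (∧-zeroʳ (parity C))

    go : ∀ D → ZeroSum M D → Acc _<_ ∣ D ─ C ∣ → form C D ≡ false
    go D zD (acc rec) with anySubset? (λ Z → zeroSum? Z ×-dec (nonempty? (Z ─ C) ×-dec (Z ─ C ⊂? D ─ C)))
    -- `D` is the sum of `Z` and `Z ⊕ D`. Both have fewer points than `D` outside `C`: the first by
    -- `Z⊂`, the second because it loses `z`.
    ... | yes (Z , zZ , (z , z∈) , Z⊂) = trans (cong (form C) (sym (⊕-cancelˡ Z D)))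
            (Subspace.⊕-closed (form-kernel C) {Z} {Z ⊕ D} (go Z zZ (rec (p⊂q⇒∣p∣<∣q∣ Z⊂)))
              (go (Z ⊕ D) (zeroSum-⊕ {Z} {D} zZ zD) (rec (p⊂q⇒∣p∣<∣q∣ rest⊂))))
      where
      rest⊂ : (Z ⊕ D) ─ C ⊂ D ─ C
      rest⊂ = subst (_⊆ D ─ C) (sym (─-distribʳ-⊕ Z D C)) (p⊕q⊆r (proj₁ Z⊂) ⊆-refl)
            , z , proj₁ Z⊂ z∈
            , λ z∈′ → x∈p⊕q⇒x∉q {p = Z} (p─q⊆p (Z ⊕ D) C z∈′) (p─q⊆p Z C z∈) (p─q⊆p D C (proj₁ Z⊂ z∈))
    ... | no none with ⊆-or-witness D C
    ...   | inj₁ D⊆C with zeroSum-⊆-circuit {C} CC zD D⊆C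
    ...     | inj₁ refl = form-⊥ C
    ...     | inj₂ refl = form-self C
    go D zD (acc rec) | no none | inj₂ (d , d∈D , d∉C) with meets? C D
    ... | no ¬m = disjoint D zD (d , d∈D) ¬m (spanned {D} zD none)
    ... | yes m with ⊆-or-witness C D
    ...   | inj₂ (c , c∈C , c∉D) = overlapping (parity (D ─ C)) refl
      where
      overlapping : ∀ b → parity (D ─ C) ≡ b → form C D ≡ false
      overlapping true  o = contradiction
        (spanned⇒oddTheta {C} {D} zC zD (c , x∈p∧x∉q⇒x∈p─q c∈C c∉D) m (spanned {D} zD none) oC o) ¬θ
      -- With `D ─ C` even, `D` and `C ∩ D` have the same parity, and the two terms of the form
      -- cancel.
      overlapping false e rewrite oC | dot-comm C D | sym (parity-─∩ D C) | e = xor-same (parity (D ∩ C))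
    -- Here `C ─ D` is empty and there is no theta. `C ⊕ D` replaces `D`: it is disjoint from `C`,
    -- generates the same space together with `C`, and has the same form value because `form C C`
    -- vanishes.
    ...   | inj₁ C⊆D = trans (cong (form C) (sym (⊕-cancelˡ C D)))
            (Subspace.⊕-closed (form-kernel C) {C} {C ⊕ D} (form-self C)
              (disjoint (C ⊕ D) (zeroSum-⊕ {C} {D} zC zD) (d , x∈p⊕q⁺ʳ d∉C d∈D)
                (λ { (x , x∈C , x∈) → x∈p⊕q⇒x∉q {p = C} x∈ x∈C (C⊆D x∈C) }) spanned′))
      where
      spanned′ : Spanned C (C ⊕ D)
      spanned′ zZ Z⊆ with spanned {D} zD none zZ (λ x∈ → narrow (Z⊆ x∈))
        where
        narrow : ∀ {x} → x ∈ C ⊎ x ∈ C ⊕ D → x ∈ C ⊎ x ∈ D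
        narrow (inj₁ x∈C) = inj₁ x∈C
        narrow (inj₂ x∈)  = inj₂ (p⊕q⊆r C⊆D ⊆-refl x∈)
      ... | inj₁ e               = inj₁ e
      ... | inj₂ (inj₁ e)        = inj₂ (inj₁ e)
      ... | inj₂ (inj₂ (inj₁ e)) = inj₂ (inj₂ (inj₂ (trans e (sym (⊕-cancelˡ C D)))))
      ... | inj₂ (inj₂ (inj₂ e)) = inj₂ (inj₂ (inj₁ e))

-- Enumerated sets

Injective : {A B : Set} → (A → B) → Set
Injective f = ∀ i j → f i ≡ f j → i ≡ j

infixr 5 _⌢_

_⌢_ : (Fin a → V) → (Fin b → V) → Fin (a + b) → V
_⌢_ {zero}  f g         = g
_⌢_ {suc a} f g zero    = f zero
_⌢_ {suc a} f g (suc i) = ((f ∘ suc) ⌢ g) i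

⌢-All : (P : V → Set) (f : Fin a → V) (g : Fin b → V) → (∀ i → P (f i)) → (∀ j → P (g j)) → ∀ i → P ((f ⌢ g) i)
⌢-All {a = zero}  P f g Pf Pg i       = Pg i
⌢-All {a = suc a} P f g Pf Pg zero    = Pf zero
⌢-All {a = suc a} P f g Pf Pg (suc i) = ⌢-All P (f ∘ suc) g (Pf ∘ suc) Pg i

⌢-injective : (f : Fin a → V) (g : Fin b → V) → Injective f → Injective g → (∀ i j → f i ≢ g j) → Injective (f ⌢ g)
⌢-injective {a = zero}  f g _     g-inj _  i       j       e = g-inj i j e
⌢-injective {a = suc a} f g f-inj g-inj f#g = go
  where
  fresh : ∀ i → f zero ≢ ((f ∘ suc) ⌢ g) i
  fresh = ⌢-All (f zero ≢_) (f ∘ suc) g (λ i e → contradiction (f-inj zero (suc i) e) λ ()) (f#g zero)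
  go : Injective (f ⌢ g)
  go zero    zero    e = refl
  go zero    (suc j) e = contradiction e (fresh j)
  go (suc i) zero    e = contradiction (sym e) (fresh i)
  go (suc i) (suc j) e = cong suc (⌢-injective (f ∘ suc) g (λ i j e → suc-injective (f-inj (suc i) (suc j) e)) g-inj (f#g ∘ suc) i j e)

-- A sum of singletons: repeated values cancel, so this is the set of values only for injective
-- maps, but parity and `dot` become termwise sums for every map.
image : (Fin k → Fin n) → Subset n
image {zero}  g = ⊥
image {suc k} g = ⁅ g zero ⁆ ⊕ image (g ∘ suc)

image-cong : {f g : Fin k → Fin n} → (∀ i → f i ≡ g i) → image f ≡ image g
image-cong {zero}  f≗g = refl
image-cong {suc k} f≗g = cong₂ _⊕_ (cong ⁅_⁆ (f≗g zero)) (image-cong (f≗g ∘ suc))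

image-∘⌢ : (h : V → Fin n) (f : Fin a → V) (g : Fin b → V) → image (h ∘ (f ⌢ g)) ≡ image (h ∘ f) ⊕ image (h ∘ g)
image-∘⌢ {a = zero}  h f g = sym (⊕-identityˡ _)
image-∘⌢ {a = suc a} h f g = trans (cong (⁅ h (f zero) ⁆ ⊕_) (image-∘⌢ h (f ∘ suc) g)) (sym (⊕-assoc _ _ _))

x∈image⁻ : (g : Fin k → Fin n) → x ∈ image g → ∃ λ i → g i ≡ x
x∈image⁻ {zero}  g x∈ = contradiction x∈ ∉⊥
x∈image⁻ {suc k} g x∈ with x∈p⊕q⁻ ⁅ g zero ⁆ (image (g ∘ suc)) x∈
... | inj₁ (x∈₀ , _) = zero , sym (x∈⁅y⁆⇒x≡y (g zero) x∈₀)
... | inj₂ (_ , x∈₁) with x∈image⁻ (g ∘ suc) x∈₁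
... | i , e = suc i , e

x∈image⁺ : (g : Fin k → Fin n) → Injective g → ∀ i → g i ∈ image g
x∈image⁺ {suc k} g g-inj zero    = x∈p⊕q⁺ˡ (x∈⁅x⁆ (g zero)) λ g₀∈ →
  let i , e = x∈image⁻ (g ∘ suc) g₀∈ in contradiction (g-inj (suc i) zero e) λ ()
x∈image⁺ {suc k} g g-inj (suc i) = x∈p⊕q⁺ʳ
  (λ gᵢ∈ → contradiction (g-inj (suc i) zero (x∈⁅y⁆⇒x≡y (g zero) gᵢ∈)) λ ())
  (x∈image⁺ (g ∘ suc) (λ i j e → suc-injective (g-inj (suc i) (suc j) e)) i)

opposite-injective : Injective (opposite {a})
opposite-injective i j eq = trans (sym (opposite-involutive i)) (trans (cong opposite eq) (opposite-involutive j))

opposite-inject₁ : (i : Fin a) → opposite (inject₁ i) ≡ suc (opposite i)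
opposite-inject₁ zero    = refl
opposite-inject₁ (suc i) = cong inject₁ (opposite-inject₁ i)

opposite-fromℕ : ∀ a → opposite (fromℕ a) ≡ zero
opposite-fromℕ zero    = refl
opposite-fromℕ (suc a) = cong inject₁ (opposite-fromℕ a)

image-opposite : (g : Fin k → Fin n) → Injective g → image (g ∘ opposite) ≡ image g
image-opposite g g-inj = ⊆-antisym
  (λ x∈ → let i , e = x∈image⁻ (g ∘ opposite) x∈ in subst (_∈ image g) e (x∈image⁺ g g-inj (opposite i)))
  (λ x∈ → let i , e = x∈image⁻ g x∈ in subst (_∈ image (g ∘ opposite)) (trans (cong g (opposite-involutive i)) e)
    (x∈image⁺ (g ∘ opposite) (λ i j e → opposite-injective i j (g-inj _ _ e)) (opposite i)))

parity-⁅⁆ : (x : Fin n) → parity ⁅ x ⁆ ≡ true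
parity-⁅⁆ x = trans (sym (parity-∣∣ ⁅ x ⁆)) (cong parityℕ (∣⁅x⁆∣≡1 x))

parity-image : (g : Fin k → Fin n) → parity (image g) ≡ parityℕ k
parity-image {zero}  {n} g = parity-⊥ n
parity-image {suc k} {n} g = trans (parity-⊕ ⁅ g zero ⁆ (image (g ∘ suc)))
  (cong₂ _xor_ (parity-⁅⁆ (g zero)) (parity-image (g ∘ suc)))

-- Walks and graph circuits

module _ (G : Graph) where

  Walk : (Fin (suc a) → Fin (nv G)) → (Fin a → Fin (ne G)) → Set
  Walk vs es = ∀ i → Joins G (es i) (vs (inject₁ i)) (vs (suc i))

  Enumerates : (Fin k → Fin (ne G)) → Subset (ne G) → Set
  Enumerates es D = ∀ e → (e ∈ D → ∃ λ i → es i ≡ e) × ((∃ λ i → es i ≡ e) → e ∈ D)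

  walk-opposite : (vs : Fin (suc a) → Fin (nv G)) (es : Fin a → Fin (ne G)) → Walk vs es → Walk (vs ∘ opposite) (es ∘ opposite)
  walk-opposite vs es w i = swap (subst (λ j → Joins G (es (opposite i)) (vs (inject₁ (opposite i))) (vs j)) (sym (opposite-inject₁ i)) (w (opposite i)))

-- Concatenation of vertex sequences whose common end point p (fromℕ a) ≡ q zero is listed once.
splice : (Fin (suc a) → V) → (Fin (suc b) → V) → Fin (suc (a + b)) → V
splice {zero}  p q         = q
splice {suc a} p q zero    = p zero
splice {suc a} p q (suc i) = splice (p ∘ suc) q i

splice-zero : (p : Fin (suc a) → V) (q : Fin (suc b) → V) → p (fromℕ a) ≡ q zero → splice p q zero ≡ p zero
splice-zero {zero}  p q e = sym e
splice-zero {suc a} p q e = refl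

splice-fromℕ : (p : Fin (suc a) → V) (q : Fin (suc b) → V) → splice p q (fromℕ (a + b)) ≡ q (fromℕ b)
splice-fromℕ {zero}  p q = refl
splice-fromℕ {suc a} p q = splice-fromℕ (p ∘ suc) q

splice-inject₁ : (p : Fin (suc a) → V) (q : Fin (suc b) → V) → ∀ i → splice p q (inject₁ i) ≡ ((p ∘ inject₁) ⌢ (q ∘ inject₁)) i
splice-inject₁ {zero}  p q i       = refl
splice-inject₁ {suc a} p q zero    = refl
splice-inject₁ {suc a} p q (suc i) = splice-inject₁ (p ∘ suc) q i

splice-injective : (p : Fin (suc a) → V) (q : Fin (suc b) → V) → Injective (p ∘ inject₁) → Injective (q ∘ inject₁) →
                   (∀ i j → p (inject₁ i) ≢ q (inject₁ j)) → Injective (splice p q ∘ inject₁)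
splice-injective p q p-inj q-inj p#q i j eq = ⌢-injective (p ∘ inject₁) (q ∘ inject₁) p-inj q-inj p#q i j
  (trans (sym (splice-inject₁ p q i)) (trans eq (splice-inject₁ p q j)))

module _ (G : Graph) where

  walk-splice : (p : Fin (suc a) → Fin (nv G)) (e : Fin a → Fin (ne G)) (q : Fin (suc b) → Fin (nv G)) (f : Fin b → Fin (ne G)) →
                Walk G p e → Walk G q f → p (fromℕ a) ≡ q zero → Walk G (splice p q) (e ⌢ f)
  walk-splice {zero}  p e q f wp wq meet i       = wq i
  walk-splice {suc a} p e q f wp wq meet zero    = subst (Joins G (e zero) (p zero)) (sym (splice-zero (p ∘ suc) q meet)) (wp zero)
  walk-splice {suc a} p e q f wp wq meet (suc i) = walk-splice (p ∘ suc) (e ∘ suc) q f (wp ∘ suc) wq meet i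

  closed-walk⇒circuit : (vs : Fin (suc a) → Fin (nv G)) (es : Fin a → Fin (ne G)) → a ≢ 0 → Walk G vs es →
                        vs (fromℕ a) ≡ vs zero → Injective (vs ∘ inject₁) → Injective es →
                        ∀ D → Enumerates G es D → GraphCircuit G D
  closed-walk⇒circuit {zero}  vs es a≢0 _ _ _ _ _ _ = contradiction refl a≢0
  closed-walk⇒circuit {suc a} vs es _ w closed v-inj e-inj D enum = a , vs , es , v-inj , closed , e-inj , w , enum

  -- Each walk is compared without its last vertex, so that each of the two junctions is counted
  -- once.
  two-walks⇒circuit : (p : Fin (suc a) → Fin (nv G)) (e : Fin a → Fin (ne G)) (q : Fin (suc b) → Fin (nv G)) (f : Fin b → Fin (ne G)) →
    a ≢ 0 → Walk G p e → Walk G q f → p (fromℕ a) ≡ q zero → q (fromℕ b) ≡ p zero →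
    Injective (p ∘ inject₁) → Injective (q ∘ inject₁) → (∀ i j → p (inject₁ i) ≢ q (inject₁ j)) →
    Injective (e ⌢ f) → ∀ D → Enumerates G (e ⌢ f) D → GraphCircuit G D
  two-walks⇒circuit {a} p e q f a≢0 wp wq meet close p-inj q-inj p#q = closed-walk⇒circuit (splice p q) (e ⌢ f)
    (a≢0 ∘ m+n≡0⇒m≡0 a) (walk-splice p e q f wp wq meet)
    (trans (splice-fromℕ p q) (trans close (sym (splice-zero p q meet))))
    (splice-injective p q p-inj q-inj p#q)

-- Circuits of an odd-C₃⁺ graph

src tgt : Fin 4 → Fin 3
src = proj₁ ∘ C3+ends
tgt = proj₂ ∘ C3+ends

module C3+Subdivision {G : Graph} (T : TotallyOddSubdivision C3+ G) where
  open TotallyOddSubdivision T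

  -- Describes half-open paths: without its last vertex a path keeps its source, without its first
  -- one its target. On different edges, half-open paths that keep different ends are disjoint.
  At : Fin 4 → Fin 3 → Fin (nv G) → Set
  At e u v = v ≡ branch u ⊎ (∃ λ i → Inner {len e} i × pv e i ≡ v)

  at-disjoint : ∀ {e e′ u u′ v v′} → e ≢ e′ → u ≢ u′ → At e u v → At e′ u′ v′ → v ≢ v′
  at-disjoint _ u≢u′ (inj₁ eq)           (inj₁ eq′)             refl = u≢u′ (branchInj _ _ (trans (sym eq) eq′))
  at-disjoint _ _    (inj₁ eq)           (inj₂ (i , inn , eq′)) refl = innerNotBranch _ i _ inn (trans eq′ eq)
  at-disjoint _ _    (inj₂ (i , inn , eq)) (inj₁ eq′)           refl = innerNotBranch _ i _ inn (trans eq eq′)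
  at-disjoint e≢e′ _ (inj₂ (i , inn , eq)) (inj₂ (i′ , inn′ , eq′)) refl = innerDisjoint _ _ i i′ e≢e′ inn inn′ (trans eq (sym eq′))

  at-inject₁ : ∀ e i → At e (src e) (pv e (inject₁ i))
  at-inject₁ e i with toℕ (inject₁ i) ≟ⁿ 0
  ... | yes z  = inj₁ (trans (cong (pv e) (toℕ-injective {j = zero} z)) (pvStart e))
  ... | no i≢0 = inj₂ (inject₁ i , (i≢0 , λ eq → <-irrefl (trans (sym (toℕ-inject₁ i)) eq) (toℕ<n i)) , refl)

  at-suc : ∀ e i → At e (tgt e) (pv e (suc i))
  at-suc e i with toℕ (suc i) ≟ⁿ len e
  ... | yes l  = inj₁ (trans (cong (pv e) (toℕ-injective (trans l (sym (toℕ-fromℕ (len e)))))) (pvEnd e))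
  ... | no i≢l = inj₂ (suc i , ((λ ()) , i≢l) , refl)

  len≢0 : ∀ e → len e ≢ 0
  len≢0 e l≡0 with trans (sym (lenOdd e)) (cong (_% 2) l≡0)
  ... | ()

  pe-injective : ∀ e → Injective (pe e)
  pe-injective e i j eq = toℕ-injective (proj₂ (edgeInj e e i j eq))

  pe-disjoint : ∀ {e e′} → e ≢ e′ → ∀ i j → pe e i ≢ pe e′ j
  pe-disjoint e≢e′ i j eq = e≢e′ (proj₁ (edgeInj _ _ i j eq))

  pv∘inject₁-injective : ∀ e → Injective (pv e ∘ inject₁)
  pv∘inject₁-injective e i j eq = inject₁-injective (pvInj e _ _ eq)

  -- Both parallel edges run from 0 to 1, so the second path is traversed backwards.
  edges-01 : Fin (len 0F + len 1F) → Fin (ne G)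
  edges-01 = pe 0F ⌢ (pe 1F ∘ opposite)

  edges-01-injective : Injective edges-01
  edges-01-injective = ⌢-injective (pe 0F) (pe 1F ∘ opposite) (pe-injective 0F)
    (λ i j eq → opposite-injective i j (pe-injective 1F _ _ eq)) (λ i j → pe-disjoint (λ ()) i (opposite j))

  circuit-01 : ∀ D → Enumerates G edges-01 D → GraphCircuit G D
  circuit-01 = two-walks⇒circuit G (pv 0F) (pe 0F) (pv 1F ∘ opposite) (pe 1F ∘ opposite) (len≢0 0F)
    (peJoins 0F) (walk-opposite G (pv 1F) (pe 1F) (peJoins 1F))
    (trans (pvEnd 0F) (sym (pvEnd 1F)))
    (trans (cong (pv 1F) (opposite-fromℕ (len 1F))) (trans (pvStart 1F) (sym (pvStart 0F))))
    (pv∘inject₁-injective 0F)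
    (λ i j eq → inject₁-injective (opposite-injective _ _ (pvInj 1F _ _ eq)))
    (λ i j → at-disjoint {0F} {1F} (λ ()) (λ ()) (at-inject₁ 0F i)
      (subst (At 1F (tgt 1F) ∘ pv 1F) (sym (opposite-inject₁ j)) (at-suc 1F (opposite j))))
    edges-01-injective

  edges-23 : ∀ e → Fin (len e + (len 2F + len 3F)) → Fin (ne G)
  edges-23 e = pe e ⌢ (pe 2F ⌢ pe 3F)

  edges-23-injective : ∀ {e} → C3+ends e ≡ (0F , 1F) → Injective (edges-23 e)
  edges-23-injective {e} ends-e = ⌢-injective (pe e) (pe 2F ⌢ pe 3F) (pe-injective e)
    (⌢-injective (pe 2F) (pe 3F) (pe-injective 2F) (pe-injective 3F) (pe-disjoint λ ()))
    (λ i → ⌢-All (pe e i ≢_) (pe 2F) (pe 3F) (pe-disjoint (λ { refl → contradiction ends-e λ () }) i) (pe-disjoint (λ { refl → contradiction ends-e λ () }) i))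

  circuit-23 : ∀ {e} → C3+ends e ≡ (0F , 1F) → ∀ D → Enumerates G (edges-23 e) D → GraphCircuit G D
  circuit-23 {e} ends-e = two-walks⇒circuit G (pv e) (pe e) (splice (pv 2F) (pv 3F)) (pe 2F ⌢ pe 3F) (len≢0 e)
    (peJoins e) (walk-splice G (pv 2F) (pe 2F) (pv 3F) (pe 3F) (peJoins 2F) (peJoins 3F) meet-23)
    (trans (pvEnd e) (trans (cong (branch ∘ proj₂) ends-e) (sym (trans (splice-zero (pv 2F) (pv 3F) meet-23) (pvStart 2F)))))
    (trans (splice-fromℕ (pv 2F) (pv 3F)) (trans (pvEnd 3F) (sym (trans (pvStart e) (cong (branch ∘ proj₁) ends-e)))))
    (pv∘inject₁-injective e)
    (splice-injective (pv 2F) (pv 3F) (pv∘inject₁-injective 2F) (pv∘inject₁-injective 3F)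
      (λ i j → at-disjoint {2F} {3F} (λ ()) (λ ()) (at-inject₁ 2F i) (at-inject₁ 3F j)))
    (λ i j eq → ⌢-All (pv e (inject₁ i) ≢_) (pv 2F ∘ inject₁) (pv 3F ∘ inject₁) (apart 2F (λ ()) i) (apart 3F (λ ()) i) j
      (trans eq (splice-inject₁ (pv 2F) (pv 3F) j)))
    (edges-23-injective ends-e)
    where
    meet-23 : pv 2F (fromℕ (len 2F)) ≡ pv 3F zero
    meet-23 = trans (pvEnd 2F) (sym (pvStart 3F))
    apart : ∀ e′ → 0F ≢ src e′ → ∀ i j → pv e (inject₁ i) ≢ pv e′ (inject₁ j)
    apart e′ 0≢ i j = at-disjoint {e} {e′} (λ { refl → 0≢ (cong proj₁ (sym ends-e)) }) (λ src≡ → 0≢ (trans (cong proj₁ (sym ends-e)) src≡))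
      (at-inject₁ e i) (at-inject₁ e′ j)

-- The two odd circuits of an odd-C₃⁺ through the subdivided path 1–2–0 share exactly that
-- path, which is even.
formVanishes⇒free : (M : BinMatroid n) → Matroid.FormVanishes M → OddC3+Free M
formVanishes⇒free {n} M vanish G T (f , f-inj , iso) = contradiction (trans (sym (vanish C₀ C₁ (cycle refl) (cycle refl))) form≡true) λ ()
  where
  open Matroid M
  open TotallyOddSubdivision T
  open C3+Subdivision T
  I : Fin 4 → Subset n
  I e = image (f ∘ pe e)
  J C₀ C₁ : Subset n
  J  = I 2F ⊕ I 3F
  C₀ = I 0F ⊕ J
  C₁ = I 1F ⊕ J

  image≡ : ∀ e → image (f ∘ edges-23 e) ≡ I e ⊕ J
  image≡ e = trans (image-∘⌢ f (pe e) (pe 2F ⌢ pe 3F)) (cong (I e ⊕_) (image-∘⌢ f (pe 2F) (pe 3F)))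

  cycle : ∀ {e} → C3+ends e ≡ (0F , 1F) → Cycle M (I e ⊕ J)
  cycle {e} ends-e = subst (Cycle M) (image≡ e) (zeroSum⇒cycle _ (circuit-zeroSum
    (Equivalence.to (iso (image es) (image (f ∘ es)) λ x → to , from) (circuit-23 ends-e (image es) λ g → x∈image⁻ es , λ { (i , refl) → x∈image⁺ es es-inj i }))))
    where
    es : Fin _ → Fin (ne G)
    es = edges-23 e
    es-inj : Injective es
    es-inj = edges-23-injective ends-e
    to : ∀ {x} → x ∈ image (f ∘ es) → ∃ λ g → g ∈ image es × f g ≡ x
    to x∈ = let i , eq = x∈image⁻ (f ∘ es) x∈ in es i , x∈image⁺ es es-inj i , eq
    from : ∀ {x} → (∃ λ g → g ∈ image es × f g ≡ x) → x ∈ image (f ∘ es)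
    from (g , g∈ , refl) with x∈image⁻ es g∈
    ... | i , refl = x∈image⁺ (f ∘ es) (λ i j eq → es-inj i j (f-inj _ _ eq)) i

  I-disjoint : ∀ {e e′} → e ≢ e′ → dot (I e) (I e′) ≡ false
  I-disjoint {e} {e′} e≢e′ = dot-disjoint {p = I e} {q = I e′} λ x∈ x∈′ →
    let i , eq = x∈image⁻ (f ∘ pe e) x∈
        j , eq′ = x∈image⁻ (f ∘ pe e′) x∈′
    in pe-disjoint e≢e′ i j (f-inj _ _ (trans eq (sym eq′)))

  parity-I : ∀ e → parity (I e) ≡ true
  parity-I e = trans (parity-image (f ∘ pe e)) (odd⇒parityℕ (len e) (lenOdd e))

  parity-J : parity J ≡ false
  parity-J = trans (parity-⊕ (I 2F) (I 3F)) (cong₂ _xor_ (parity-I 2F) (parity-I 3F))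

  parity-C : ∀ e → parity (I e ⊕ J) ≡ true
  parity-C e = trans (parity-⊕ (I e) J) (cong₂ _xor_ (parity-I e) parity-J)

  dot-I-J : ∀ {e} → e ≢ 2F → e ≢ 3F → dot (I e) J ≡ false
  dot-I-J {e} e≢2 e≢3 = trans (dot-⊕ʳ (I e) (I 2F) (I 3F)) (cong₂ _xor_ (I-disjoint e≢2) (I-disjoint e≢3))

  dot≡false : dot C₀ C₁ ≡ false
  dot≡false = trans (dot-⊕ʳ C₀ (I 1F) J) (cong₂ _xor_
    (trans (dot-⊕ˡ (I 0F) J (I 1F)) (cong₂ _xor_ (I-disjoint λ ()) (trans (dot-comm J (I 1F)) (dot-I-J (λ ()) (λ ())))))
    (trans (dot-⊕ˡ (I 0F) J J) (cong₂ _xor_ (dot-I-J (λ ()) (λ ())) (trans (dot-self J) parity-J))))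

  form≡true : form C₀ C₁ ≡ true
  form≡true = cong₂ _xor_ dot≡false (cong₂ _∧_ (parity-C 0F) (parity-C 1F))

-- Enumerations of subsets and codes for finite disjoint unions

enumerate : (p : Subset n) → Σ (Fin ∣ p ∣ → Fin n) λ g → Injective g × image g ≡ p
enumerate []          = (λ ()) , (λ ()) , refl
enumerate (b ∷ p) with enumerate p
enumerate (b ∷ p) | g , g-inj , image≡ = add b
  where
  image-suc : ∀ {k} (g : Fin k → Fin _) → image (suc ∘ g) ≡ false ∷ image g
  image-suc {zero}  g = refl
  image-suc {suc k} g = cong ((false ∷ ⁅ g zero ⁆) ⊕_) (image-suc (g ∘ suc))
  add : ∀ b → Σ (Fin ∣ b ∷ p ∣ → Fin _) λ g → Injective g × image g ≡ b ∷ p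
  add false = suc ∘ g , (λ i j e → g-inj i j (suc-injective e)) , trans (image-suc g) (cong (false ∷_) image≡)
  add true  = g′ , g′-inj , trans (cong (⁅ zero ⁆ ⊕_) (image-suc g)) (cong (true ∷_) (trans (⊕-identityˡ _) image≡))
    where
    g′ : Fin (suc ∣ p ∣) → Fin _
    g′ zero    = zero
    g′ (suc i) = suc (g i)
    g′-inj : Injective g′
    g′-inj zero    zero    _ = refl
    g′-inj (suc i) (suc j) e = cong suc (g-inj i j (suc-injective e))

-- An odd size is a successor; `m` will be the number of inner vertices of the path with these
-- edges.
OddEnumeration : Subset n → Set
OddEnumeration {n} p = Σ ℕ λ m → Σ (Fin (suc m) → Fin n) λ g → Injective g × image g ≡ p × Odd (suc m)

enumerate-odd : (p : Subset n) → parity p ≡ true → OddEnumeration p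
enumerate-odd p o with ∣ p ∣ | enumerate p | parity⇒odd p o
... | suc m | g , g-inj , image≡ | odd = m , g , g-inj , image≡ , odd

total : (Fin k → ℕ) → ℕ
total {zero}  m = 0
total {suc k} m = m zero + total (m ∘ suc)

encode : (m : Fin k → ℕ) → Σ (Fin k) (Fin ∘ m) → Fin (total m)
encode {suc k} m (zero  , i) = i ↑ˡ total (m ∘ suc)
encode {suc k} m (suc e , i) = m zero ↑ʳ encode (m ∘ suc) (e , i)

decode : (m : Fin k → ℕ) → Fin (total m) → Σ (Fin k) (Fin ∘ m)
decode {suc k} m j with splitAt (m zero) j
... | inj₁ i  = zero , i
... | inj₂ j′ = let e , i = decode (m ∘ suc) j′ in suc e , i

decode-encode : (m : Fin k → ℕ) → ∀ x → decode m (encode m x) ≡ x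
decode-encode {suc k} m (zero  , i) rewrite splitAt-↑ˡ (m zero) i (total (m ∘ suc)) = refl
decode-encode {suc k} m (suc e , i) rewrite splitAt-↑ʳ (m zero) (total (m ∘ suc)) (encode (m ∘ suc) (e , i))
  | decode-encode (m ∘ suc) (e , i) = refl

encode-decode : (m : Fin k → ℕ) → ∀ j → encode m (decode m j) ≡ j
encode-decode {suc k} m j with splitAt (m zero) j in eq
... | inj₁ i  = splitAt⁻¹-↑ˡ eq
... | inj₂ j′ = trans (cong (m zero ↑ʳ_) (encode-decode (m ∘ suc) j′)) (splitAt⁻¹-↑ʳ eq)

-- Sums and partial sums over F₂

⨁ : (Fin k → Bool) → Bool
⨁ {zero}  w = false
⨁ {suc k} w = w zero xor ⨁ (w ∘ suc)

⨁-cong : {w w′ : Fin k → Bool} → (∀ i → w i ≡ w′ i) → ⨁ w ≡ ⨁ w′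
⨁-cong {zero}  w≗ = refl
⨁-cong {suc k} w≗ = cong₂ _xor_ (w≗ zero) (⨁-cong (w≗ ∘ suc))

xor-cancel-middle : ∀ a b c → (a xor b) xor (b xor c) ≡ a xor c
xor-cancel-middle a b c = begin
  (a xor b) xor (b xor c)  ≡⟨ xor-assoc a b (b xor c) ⟩
  a xor (b xor (b xor c))  ≡⟨ cong (a xor_) (xor-assoc b b c) ⟨
  a xor ((b xor b) xor c)  ≡⟨ cong (λ t → a xor (t xor c)) (xor-same b) ⟩
  a xor c                  ∎
  where open ≡-Reasoning

xor-cancelˡ : ∀ a b c → (a xor b) xor (a xor c) ≡ b xor c
xor-cancelˡ a b c = trans (cong (_xor (a xor c)) (xor-comm a b)) (xor-cancel-middle b a c)

⨁-telescope : (h : Fin (suc k) → Bool) → ⨁ (λ i → h (inject₁ i) xor h (suc i)) ≡ h zero xor h (fromℕ k)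
⨁-telescope {zero}  h = sym (xor-same (h zero))
⨁-telescope {suc k} h = trans (cong ((h zero xor h (suc zero)) xor_) (⨁-telescope (h ∘ suc)))
  (xor-cancel-middle (h zero) (h (suc zero)) (h (fromℕ (suc k))))

prefix : (Fin k → Bool) → Fin (suc k) → Bool
prefix w zero            = false
prefix {suc k} w (suc i) = w zero xor prefix (w ∘ suc) i

prefix-fromℕ : (w : Fin k → Bool) → prefix w (fromℕ k) ≡ ⨁ w
prefix-fromℕ {zero}  w = refl
prefix-fromℕ {suc k} w = cong (w zero xor_) (prefix-fromℕ (w ∘ suc))

prefix-step : (w : Fin k → Bool) → ∀ i → prefix w (inject₁ i) xor prefix w (suc i) ≡ w i
prefix-step w zero    = xor-identityʳ (w zero)
prefix-step w (suc i) = trans (xor-cancelˡ (w zero) (prefix (w ∘ suc) (inject₁ i)) (prefix (w ∘ suc) (suc i))) (prefix-step (w ∘ suc) i)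

dot-⁅⁆ : (x : Fin n) (t : Subset n) → dot ⁅ x ⁆ t ≡ lookup t x
dot-⁅⁆ zero    (b ∷ t) = trans (cong (b xor_) (dot-⊥ˡ t)) (xor-identityʳ b)
dot-⁅⁆ (suc x) (b ∷ t) = dot-⁅⁆ x t

dot-image : (g : Fin k → Fin n) (t : Subset n) → dot (image g) t ≡ ⨁ (lookup t ∘ g)
dot-image {zero}  g t = dot-⊥ˡ t
dot-image {suc k} g t = trans (dot-⊕ˡ ⁅ g zero ⁆ (image (g ∘ suc)) t) (cong₂ _xor_ (dot-⁅⁆ (g zero) t) (dot-image (g ∘ suc) t))

-- The odd-C₃⁺ graph with path lengths suc (m e)

module C3+Graph (m : Fin 4 → ℕ) (odd : ∀ e → Odd (suc (m e))) where

  Vertex : Set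
  Vertex = Fin 3 ⊎ Σ (Fin 4) (Fin ∘ m)

  encodeV : Vertex → Fin (3 + total m)
  encodeV (inj₁ u) = u ↑ˡ total m
  encodeV (inj₂ x) = 3 ↑ʳ encode m x

  decodeV : Fin (3 + total m) → Vertex
  decodeV v with splitAt 3 v
  ... | inj₁ u = inj₁ u
  ... | inj₂ j = inj₂ (decode m j)

  decodeV-encodeV : ∀ v → decodeV (encodeV v) ≡ v
  decodeV-encodeV (inj₁ u) rewrite splitAt-↑ˡ 3 u (total m) = refl
  decodeV-encodeV (inj₂ x) rewrite splitAt-↑ʳ 3 (total m) (encode m x) = cong inj₂ (decode-encode m x)

  encodeV-decodeV : ∀ v → encodeV (decodeV v) ≡ v
  encodeV-decodeV v with splitAt 3 v in eq
  ... | inj₁ u = splitAt⁻¹-↑ˡ eq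
  ... | inj₂ j = trans (cong (3 ↑ʳ_) (encode-decode m j)) (splitAt⁻¹-↑ʳ eq)

  encodeV-injective : Injective encodeV
  encodeV-injective v w eq = trans (sym (decodeV-encodeV v)) (trans (cong decodeV eq) (decodeV-encodeV w))

  pathV : ∀ e → Fin (suc (suc (m e))) → Vertex
  pathV e zero    = inj₁ (src e)
  pathV e (suc j) with view j
  ... | ‵fromℕ     = inj₁ (tgt e)
  ... | ‵inject₁ i = inj₂ (e , i)

  pathV-injective : ∀ e → Injective (pathV e)
  pathV-injective e zero zero _ = refl
  pathV-injective e zero (suc j) eq with view j
  ... | ‵fromℕ = contradiction (inj₁-injective eq) (C3+noLoop e)
  pathV-injective e (suc i) zero eq with view i
  ... | ‵fromℕ = contradiction (inj₁-injective (sym eq)) (C3+noLoop e)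
  pathV-injective e (suc i) (suc j) eq with view i | view j | eq
  ... | ‵fromℕ     | ‵fromℕ     | _    = refl
  ... | ‵inject₁ i | ‵inject₁ j | refl = refl

  pathV-fromℕ : ∀ e → pathV e (fromℕ (suc (m e))) ≡ inj₁ (tgt e)
  pathV-fromℕ e rewrite view-fromℕ (m e) = refl

  pathV-inner : ∀ e i → pathV e (suc (inject₁ i)) ≡ inj₂ (e , i)
  pathV-inner e i rewrite view-inject₁ i = refl

  inner⇒inj₂ : ∀ e i → Inner {suc (m e)} i → ∃ λ j → pathV e i ≡ inj₂ (e , j)
  inner⇒inj₂ e zero    (i≢0 , _) = contradiction refl i≢0
  inner⇒inj₂ e (suc i) (_ , i≢l) with view i
  ... | ‵fromℕ     = contradiction (cong suc (toℕ-fromℕ (m e))) i≢l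
  ... | ‵inject₁ j = j , refl

  lenE : Fin 4 → ℕ
  lenE = suc ∘ m

  endsG : Fin (total lenE) → Fin (3 + total m) × Fin (3 + total m)
  endsG g = let e , i = decode lenE g in encodeV (pathV e (inject₁ i)) , encodeV (pathV e (suc i))

  graph : Graph
  graph = record
    { nv = 3 + total m
    ; ne = total lenE
    ; ends = endsG
    ; noLoop = λ g eq → let e , i = decode lenE g in
        inject₁≢suc i (pathV-injective e _ _ (encodeV-injective _ _ eq))
    }
    where
    inject₁≢suc : ∀ {a} (i : Fin a) → inject₁ i ≢ suc i
    inject₁≢suc i eq = <-irrefl (trans (sym (toℕ-inject₁ i)) (cong toℕ eq)) (n<1+n (toℕ i))

  subdivision : TotallyOddSubdivision C3+ graph
  subdivision = record
    { branch = encodeV ∘ inj₁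
    ; branchInj = λ u w eq → inj₁-injective (encodeV-injective _ _ eq)
    ; len = lenE
    ; lenOdd = odd
    ; pv = λ e → encodeV ∘ pathV e
    ; pe = λ e i → encode lenE (e , i)
    ; pvInj = λ e i j eq → pathV-injective e i j (encodeV-injective _ _ eq)
    ; pvStart = λ e → refl
    ; pvEnd = λ e → cong encodeV (pathV-fromℕ e)
    ; peJoins = λ e i → inj₁ (cong (λ (e , i) → encodeV (pathV e (inject₁ i)) , encodeV (pathV e (suc i))) (decode-encode lenE (e , i)))
    ; innerNotBranch = λ e i u inn eq → let j , eq′ = inner⇒inj₂ e i inn in
        contradiction (trans (sym eq′) (encodeV-injective _ (inj₁ u) eq)) λ ()
    ; innerDisjoint = λ e e′ i i′ e≢e′ inn inn′ eq →
        let j , eq₁ = inner⇒inj₂ e i inn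
            j′ , eq₂ = inner⇒inj₂ e′ i′ inn′
        in e≢e′ (cong proj₁ (inj₂-injective (trans (sym eq₁) (trans (encodeV-injective _ _ eq) eq₂))))
    ; vertCover = λ w → cover w (decodeV w) (encodeV-decodeV w)
    ; edgeCover = λ g → let e , i = decode lenE g in e , i , encode-decode lenE g
    ; edgeInj = λ e e′ i i′ eq → components (trans (sym (decode-encode lenE (e , i))) (trans (cong (decode lenE) eq) (decode-encode lenE (e′ , i′))))
    }
    where
    cover : ∀ w v → encodeV v ≡ w → (∃ λ u → encodeV (inj₁ u) ≡ w) ⊎ (∃ λ e → ∃ λ i → encodeV (pathV e i) ≡ w)
    cover w (inj₁ u)       eq = inj₁ (u , eq)
    cover w (inj₂ (e , i)) eq = inj₂ (e , suc (inject₁ i) , trans (cong encodeV (pathV-inner e i)) eq)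
    components : ∀ {e e′} {i : Fin (lenE e)} {i′ : Fin (lenE e′)} → (e , i) ≡ (e′ , i′) → e ≡ e′ × toℕ i ≡ toℕ i′
    components refl = refl , refl

  -- A weighting of the edges with equal sums along the three paths from 0 to 1 is a cut:
  -- it is the coboundary of its partial sums along the paths.
  module Potential (w : ∀ e → Fin (lenE e) → Bool)
                   (balanced₁ : ⨁ (w 1F) ≡ ⨁ (w 0F))
                   (balanced₂ : ⨁ (w 0F) xor (⨁ (w 2F) xor ⨁ (w 3F)) ≡ false) where

    -- Edges 0 and 2 form a spanning tree of C₃⁺ and dictate these values; the two balance
    -- hypotheses say that the paths 1 and 3 agree with them.
    base : Fin 3 → Bool
    base 0F = false
    base 1F = ⨁ (w 0F)
    base 2F = ⨁ (w 0F) xor ⨁ (w 2F)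

    potential : Vertex → Bool
    potential (inj₁ u)       = base u
    potential (inj₂ (e , i)) = base (src e) xor prefix (w e) (suc (inject₁ i))

    potential-pathV : ∀ e i → potential (pathV e i) ≡ base (src e) xor prefix (w e) i
    potential-pathV e zero = sym (xor-identityʳ (base (src e)))
    potential-pathV e (suc j) with view j
    ... | ‵inject₁ i = refl
    ... | ‵fromℕ     = trans (closes e) (cong (base (src e) xor_) (sym (prefix-fromℕ (w e))))
      where
      closes : ∀ e → base (tgt e) ≡ base (src e) xor ⨁ (w e)
      closes 0F = refl
      closes 1F = sym balanced₁
      closes 2F = refl
      closes 3F = sym (trans (xor-assoc (⨁ (w 0F)) (⨁ (w 2F)) (⨁ (w 3F))) balanced₂)

    weight : Fin (total lenE) → Bool
    weight g = let e , i = decode lenE g in w e i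

    weight-ends : ∀ g → potential (decodeV (proj₁ (endsG g))) xor potential (decodeV (proj₂ (endsG g))) ≡ weight g
    weight-ends g = let e , i = decode lenE g in begin
      potential (decodeV (encodeV (pathV e (inject₁ i)))) xor potential (decodeV (encodeV (pathV e (suc i))))
        ≡⟨ cong₂ _xor_ (cong potential (decodeV-encodeV (pathV e (inject₁ i)))) (cong potential (decodeV-encodeV (pathV e (suc i)))) ⟩
      potential (pathV e (inject₁ i)) xor potential (pathV e (suc i))
        ≡⟨ cong₂ _xor_ (potential-pathV e (inject₁ i)) (potential-pathV e (suc i)) ⟩
      (base (src e) xor prefix (w e) (inject₁ i)) xor (base (src e) xor prefix (w e) (suc i))
        ≡⟨ xor-cancelˡ (base (src e)) (prefix (w e) (inject₁ i)) (prefix (w e) (suc i)) ⟩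
      prefix (w e) (inject₁ i) xor prefix (w e) (suc i)
        ≡⟨ prefix-step (w e) i ⟩
      w e i ∎
      where open ≡-Reasoning

    weight-joins : ∀ {g u v} → Joins graph g u v → weight g ≡ potential (decodeV u) xor potential (decodeV v)
    weight-joins {g} (inj₁ refl) = sym (weight-ends g)
    weight-joins {g} (inj₂ refl) = trans (sym (weight-ends g)) (xor-comm (potential (decodeV (proj₁ (endsG g)))) _)

    closed-walk-balanced : ∀ {a} (vs : Fin (suc a) → Fin (nv graph)) (es : Fin a → Fin (ne graph)) →
                           Walk graph vs es → vs (fromℕ a) ≡ vs zero → ⨁ (weight ∘ es) ≡ false
    closed-walk-balanced {a} vs es walk closed = begin
      ⨁ (weight ∘ es)                                ≡⟨ ⨁-cong (λ i → weight-joins {es i} (walk i)) ⟩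
      ⨁ (λ i → h (inject₁ i) xor h (suc i))          ≡⟨ ⨁-telescope h ⟩
      h zero xor h (fromℕ a)                         ≡⟨ cong (λ v → h zero xor potential (decodeV v)) closed ⟩
      h zero xor h zero                              ≡⟨ xor-same (h zero) ⟩
      false                                          ∎
      where
      open ≡-Reasoning
      h : Fin (suc a) → Bool
      h = potential ∘ decodeV ∘ vs

-- Realising an odd theta

module _ {n : ℕ} (M : BinMatroid n) where
  open Matroid M

  -- The elements of each `S e` may be placed along their path in any order. A matroid circuit is
  -- one of the three cycles of the theta, each traced by an explicit closed walk; conversely a
  -- graph circuit has a zero-sum image, so `zeroSum-cases` makes it one of these three.
  realise : (S : Fin 4 → Subset n) → (∀ e → parity (S e) ≡ true) → (∀ {x} → x ∈ S 2F → x ∉ S 3F) →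
            Theta M (S 0F) (S 1F) (S 2F ⊕ S 3F) → ¬ OddC3+Free M
  realise S odd S₂#S₃ θ free = free graph subdivision (f , f-injective , λ D C C≡fD → mk⇔ (to D C C≡fD) (from D C C≡fD))
    where
    open Theta θ
    m : Fin 4 → ℕ
    m e = proj₁ (enumerate-odd (S e) (odd e))
    g : ∀ e → Fin (suc (m e)) → Fin n
    g e = proj₁ (proj₂ (enumerate-odd (S e) (odd e)))
    g-injective : ∀ e → Injective (g e)
    g-injective e = proj₁ (proj₂ (proj₂ (enumerate-odd (S e) (odd e))))
    image-g : ∀ e → image (g e) ≡ S e
    image-g e = proj₁ (proj₂ (proj₂ (proj₂ (enumerate-odd (S e) (odd e)))))
    open C3+Graph m (λ e → proj₂ (proj₂ (proj₂ (proj₂ (enumerate-odd (S e) (odd e))))))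
    open TotallyOddSubdivision subdivision using (pe)
    open C3+Subdivision subdivision using (edges-01; edges-01-injective; circuit-01; edges-23; edges-23-injective; circuit-23)

    g∈S : ∀ e i → g e i ∈ S e
    g∈S e i = subst (g e i ∈_) (image-g e) (x∈image⁺ (g e) (g-injective e) i)

    S₂⊆ : S 2F ⊆ S 2F ⊕ S 3F
    S₂⊆ x∈ = x∈p⊕q⁺ˡ x∈ (S₂#S₃ x∈)
    S₃⊆ : S 3F ⊆ S 2F ⊕ S 3F
    S₃⊆ x∈ = x∈p⊕q⁺ʳ (λ x∈₂ → S₂#S₃ x∈₂ x∈) x∈

    S-injective : ∀ {x} e e′ → x ∈ S e → x ∈ S e′ → e ≡ e′
    S-injective 0F 0F _ _ = refl
    S-injective 0F 1F p q = contradiction q (P#Q p)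
    S-injective 0F 2F p q = contradiction (S₂⊆ q) (P#R p)
    S-injective 0F 3F p q = contradiction (S₃⊆ q) (P#R p)
    S-injective 1F 0F p q = contradiction p (P#Q q)
    S-injective 1F 1F _ _ = refl
    S-injective 1F 2F p q = contradiction (S₂⊆ q) (Q#R p)
    S-injective 1F 3F p q = contradiction (S₃⊆ q) (Q#R p)
    S-injective 2F 0F p q = contradiction (S₂⊆ p) (P#R q)
    S-injective 2F 1F p q = contradiction (S₂⊆ p) (Q#R q)
    S-injective 2F 2F _ _ = refl
    S-injective 2F 3F p q = contradiction q (S₂#S₃ p)
    S-injective 3F 0F p q = contradiction (S₃⊆ p) (P#R q)
    S-injective 3F 1F p q = contradiction (S₃⊆ p) (Q#R q)
    S-injective 3F 2F p q = contradiction p (S₂#S₃ q)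
    S-injective 3F 3F _ _ = refl

    f′ : Σ (Fin 4) (Fin ∘ lenE) → Fin n
    f′ (e , i) = g e i

    f′-injective : Injective f′
    f′-injective (e , i) (e′ , i′) eq with S-injective e e′ (g∈S e i) (subst (_∈ S e′) (sym eq) (g∈S e′ i′))
    ... | refl = cong (e ,_) (g-injective e i i′ eq)

    f : Fin (ne graph) → Fin n
    f = f′ ∘ decode lenE

    f-injective : Injective f
    f-injective j j′ eq = trans (sym (encode-decode lenE j))
      (trans (cong (encode lenE) (f′-injective _ _ eq)) (encode-decode lenE j′))

    image-pe : ∀ e → image (f ∘ pe e) ≡ S e
    image-pe e = trans (image-cong (λ i → cong f′ (decode-encode lenE (e , i)))) (image-g e)

    IsImage : Subset (ne graph) → Subset n → Set
    IsImage D C = ∀ x → (x ∈ C → ∃ λ e → e ∈ D × f e ≡ x) × ((∃ λ e → e ∈ D × f e ≡ x) → x ∈ C)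

    covered : ∀ j → f j ∈ S 0F ⊎ f j ∈ S 1F ⊎ f j ∈ S 2F ⊕ S 3F
    covered j with decode lenE j
    ... | 0F , i = inj₁ (g∈S 0F i)
    ... | 1F , i = inj₂ (inj₁ (g∈S 1F i))
    ... | 2F , i = inj₂ (inj₂ (S₂⊆ (g∈S 2F i)))
    ... | 3F , i = inj₂ (inj₂ (S₃⊆ (g∈S 3F i)))

    image-cases : ∀ {D C} → IsImage D C → ZeroSum M C →
                  C ≡ ⊥ ⊎ C ≡ S 0F ⊕ S 1F ⊎ C ≡ S 0F ⊕ (S 2F ⊕ S 3F) ⊎ C ≡ S 1F ⊕ (S 2F ⊕ S 3F)
    image-cases C≡fD zC = zeroSum-cases zC λ {x} x∈C →
      let j , _ , fj≡x = proj₁ (C≡fD x) x∈C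
      in subst (λ x → x ∈ S 0F ⊎ x ∈ S 1F ⊎ x ∈ S 2F ⊕ S 3F) fj≡x (covered j)

    enumerated : ∀ {D C k} → IsImage D C → (es : Fin k → Fin (ne graph)) → Injective es →
                 C ≡ image (f ∘ es) → Enumerates graph es D
    enumerated C≡fD es es-inj refl e =
        (λ e∈D → let i , eq = x∈image⁻ (f ∘ es) (proj₂ (C≡fD (f e)) (e , e∈D , refl)) in i , f-injective _ _ eq)
      , λ { (i , refl) → let e′ , e′∈D , eq = proj₁ (C≡fD (f (es i))) (x∈image⁺ (f ∘ es) (λ i j eq → es-inj i j (f-injective _ _ eq)) i)
                         in subst (_∈ _) (f-injective _ _ eq) e′∈D }

    from : ∀ D C → IsImage D C → Circuit M C → GraphCircuit graph D
    from D C C≡fD CC with image-cases {D} C≡fD (circuit-zeroSum {C} CC)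
    ... | inj₁ C≡⊥ = contradiction C≡⊥ (nonempty⇒p≢⊥ (circuit-nonempty {C} CC))
    ... | inj₂ (inj₁ C≡) = circuit-01 D (enumerated {D} C≡fD edges-01 edges-01-injective (trans C≡ (sym image≡)))
      where
      image≡ : image (f ∘ edges-01) ≡ S 0F ⊕ S 1F
      image≡ = trans (image-∘⌢ f (pe 0F) (pe 1F ∘ opposite)) (cong₂ _⊕_ (image-pe 0F)
        (trans (image-opposite (f ∘ pe 1F) (λ i j eq → C3+Subdivision.pe-injective subdivision 1F i j (f-injective _ _ eq))) (image-pe 1F)))
    ... | inj₂ (inj₂ rest) = by-path rest
      where
      image≡ : ∀ e → image (f ∘ edges-23 e) ≡ S e ⊕ (S 2F ⊕ S 3F)
      image≡ e = trans (image-∘⌢ f (pe e) (pe 2F ⌢ pe 3F)) (cong₂ _⊕_ (image-pe e)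
        (trans (image-∘⌢ f (pe 2F) (pe 3F)) (cong₂ _⊕_ (image-pe 2F) (image-pe 3F))))
      through : ∀ {e} → C3+ends e ≡ (0F , 1F) → C ≡ S e ⊕ (S 2F ⊕ S 3F) → GraphCircuit graph D
      through {e} ends-e C≡ = circuit-23 ends-e D
        (enumerated {D} C≡fD (edges-23 e) (edges-23-injective ends-e) (trans C≡ (sym (image≡ e))))
      by-path : C ≡ S 0F ⊕ (S 2F ⊕ S 3F) ⊎ C ≡ S 1F ⊕ (S 2F ⊕ S 3F) → GraphCircuit graph D
      by-path (inj₁ C≡) = through refl C≡
      by-path (inj₂ C≡) = through refl C≡

    to : ∀ D C → IsImage D C → GraphCircuit graph D → Circuit M C
    to D C C≡fD (k , vs , es , _ , closed , es-inj , walk , enum) = conclude (image-cases {D} C≡fD zC)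
      where
      C≡ : C ≡ image (f ∘ es)
      C≡ = ⊆-antisym C⊆ ⊆C
        where
        C⊆ : C ⊆ image (f ∘ es)
        C⊆ {x} x∈C with proj₁ (C≡fD x) x∈C
        ... | e , e∈D , refl with proj₁ (enum e) e∈D
        ...   | i , refl = x∈image⁺ (f ∘ es) (λ i j eq → es-inj i j (f-injective _ _ eq)) i
        ⊆C : image (f ∘ es) ⊆ C
        ⊆C {x} x∈ with x∈image⁻ (f ∘ es) x∈
        ... | i , refl = proj₂ (C≡fD x) (es i , proj₂ (enum (es i)) (i , refl) , refl)
      -- Row `r` is a weighting of the edges. Orthogonality to `P ⊕ Q` and `P ⊕ R` gives it equal
      -- sums along the three paths, so it is a cut and sums to zero along the closed walk.
      zC : ZeroSum M C
      zC r = parity⇒even (C ∩ row) (trans (cong (λ C → dot C row) C≡) (trans (dot-image (f ∘ es) row)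
        (Potential.closed-walk-balanced w balanced₁ balanced₂ vs es walk closed)))
        where
        row : Subset n
        row = tabulate (A M r)
        w : ∀ e → Fin (lenE e) → Bool
        w e i = lookup row (g e i)
        ⨁w : ∀ e → ⨁ (w e) ≡ dot (S e) row
        ⨁w e = trans (sym (dot-image (g e) row)) (cong (λ p → dot p row) (image-g e))
        balanced₁ : ⨁ (w 1F) ≡ ⨁ (w 0F)
        balanced₁ = trans (⨁w 1F) (trans (sym (xor≡false⇒≡ _ _ (trans (sym (dot-⊕ˡ (S 0F) (S 1F) row))
          (even⇒parity ((S 0F ⊕ S 1F) ∩ row) (P⊕Q-zeroSum r))))) (sym (⨁w 0F)))
        balanced₂ : ⨁ (w 0F) xor (⨁ (w 2F) xor ⨁ (w 3F)) ≡ false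
        balanced₂ = trans (cong₂ _xor_ (⨁w 0F) (trans (cong₂ _xor_ (⨁w 2F) (⨁w 3F)) (sym (dot-⊕ˡ (S 2F) (S 3F) row))))
          (trans (sym (dot-⊕ˡ (S 0F) (S 2F ⊕ S 3F) row)) (even⇒parity ((S 0F ⊕ (S 2F ⊕ S 3F)) ∩ row) (P⊕R-zeroSum r)))
      C-nonempty : Nonempty C
      C-nonempty = f (es zero) , proj₂ (C≡fD _) (es zero , proj₂ (enum (es zero)) (zero , refl) , refl)
      conclude : C ≡ ⊥ ⊎ C ≡ S 0F ⊕ S 1F ⊎ C ≡ S 0F ⊕ (S 2F ⊕ S 3F) ⊎ C ≡ S 1F ⊕ (S 2F ⊕ S 3F) → Circuit M C
      conclude (inj₁ e)                  = contradiction e (nonempty⇒p≢⊥ C-nonempty)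
      conclude (inj₂ (inj₁ e))           = subst (Circuit M) (sym e) (theta-circuit M θ)
      conclude (inj₂ (inj₂ (inj₁ e)))    = subst (Circuit M) (sym e) (theta-circuit M (theta-swapʳ M θ))
      conclude (inj₂ (inj₂ (inj₂ e)))    = subst (Circuit M) (sym e) (theta-circuit M (theta-swapʳ M (theta-swap M θ)))

  free⇒¬oddTheta : OddC3+Free M → ¬ OddTheta M
  free⇒¬oddTheta free (P , Q , R , θ , oP , oQ , eR) = realise S odd S₂#S₃
    (subst (Theta M P Q) (sym (⊕-cancelˡ ⁅ y ⁆ R)) θ) free
    where
    y : Fin n
    y = proj₁ (Theta.R-nonempty θ)
    S : Fin 4 → Subset n
    S 0F = P
    S 1F = Q
    -- An arbitrary element `y` of the even path is split off; the rest of the path has odd size.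
    S 2F = ⁅ y ⁆
    S 3F = ⁅ y ⁆ ⊕ R
    odd : ∀ e → parity (S e) ≡ true
    odd 0F = oP
    odd 1F = oQ
    odd 2F = parity-⁅⁆ y
    odd 3F = trans (parity-⊕ ⁅ y ⁆ R) (cong₂ _xor_ (parity-⁅⁆ y) eR)
    S₂#S₃ : ∀ {z} → z ∈ ⁅ y ⁆ → z ∉ ⁅ y ⁆ ⊕ R
    S₂#S₃ z∈ z∈′ = x∈p⊕q⇒x∉q {p = ⁅ y ⁆} z∈′ z∈ (subst (_∈ R) (sym (x∈⁅y⁆⇒x≡y y z∈)) (proj₂ (Theta.R-nonempty θ)))

  free⇒formVanishes : Connected M → ∃ OddCircuit → OddC3+Free M → FormVanishes
  free⇒formVanishes conn odd free C D cC cD = trans (form-comm C D)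
    (oddCircuits-span conn odd (form-kernel D) (λ E oE → trans (form-comm D E)
      (¬oddTheta⇒form≡false M conn (free⇒¬oddTheta free) oE D (cycle⇒zeroSum D cD))) C cC)

theorem2p12 : (n : ℕ) (M : BinMatroid n) → Loopless M → Connected M → ¬ Bipartite M
    → (OddC3+Free M ⇔ HasTotallyOddCircuitBasis M)
    × (HasTotallyOddCircuitBasis M ⇔ EveryOddCycleBasisTotallyOdd M)
theorem2p12 n M _ conn ¬bip =
    mk⇔ (every⇒has ∘ formVanishes⇒totallyOdd ∘ free⇒formVanishes M conn odd)
        (formVanishes⇒free M ∘ totallyOdd⇒formVanishes)
  , mk⇔ (formVanishes⇒totallyOdd ∘ totallyOdd⇒formVanishes) every⇒has
  where
  open Matroid M
  odd : ∃ OddCircuit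
  odd = ¬bipartite⇒oddCircuit ¬bip
  -- Condition (iii) is not vacuous: a basis of odd circuits exists, and (iii) makes it totally odd.
  every⇒has : EveryOddCycleBasisTotallyOdd M → HasTotallyOddCircuitBasis M
  every⇒has every with odd-circuit-basis conn odd
  ... | k , B , circuits , oddB = k , B , circuits , every k B oddB
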